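{- Let $E: Y^2 = X^3 + AX + B$ be an elliptic curve with $A, B \in \mathbb{Z}$ and $4A^3+27B^2\neq 0$. Let $(x,y) \in E(\mathbb{Q})$ be a point of order nine, and write $[3](x,y) = (x',y')$. Then $x, x', y' \in \mathbb{Z}$ and $(x - x')$ divides $(2y')^6$ in $\mathbb{Z}$.
   Context: $E(\mathbb{Q})$ denotes the group of rational points of the projective closure of $E$ with the usual chord–tangent group law, and $[3](x,y)$ denotes $(x,y)+(x,y)+(x,y)$ in this group. -}

module Defs where

open import Data.Nat as ℕ using (ℕ; zero; suc; _<_)
open import Data.Integer as ℤ using (ℤ)
open import Data.Rational using (ℚ; _/_; _+_; _*_; _-_; _÷_; 0ℚ; ≢-nonZero)
open import Data.Rational.Properties using (_≟_)
open import Relation.Binary.PropositionalEquality using (_≡_; _≢_)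
open import Relation.Nullary using (yes; no)

ι : ℤ → ℚ
ι z = z / 1

-- total division on ℚ: p ⊘ q = p / q for q ≠ 0 (value 0 when q = 0; this
-- default is never used by the addition law on points of a nonsingular curve)
_⊘_ : ℚ → ℚ → ℚ
p ⊘ q with q ≟ 0ℚ
... | yes _ = 0ℚ
... | no q≢0 = let instance _ = ≢-nonZero q≢0 in p ÷ q

data Pt : Set where
  O   : Pt
  aff : ℚ → ℚ → Pt

onCurve : ℤ → ℤ → ℚ → ℚ → Set
onCurve A B x y = y * y ≡ x * x * x + ι A * x + ι B

OnE : ℤ → ℤ → Pt → Set
OnE A B O = Data.Unit.⊤ where import Data.Unit
OnE A B (aff x y) = onCurve A B x y

add : ℤ → ℤ → Pt → Pt → Pt
add A B O Q = Q
add A B (aff x₁ y₁) O = aff x₁ y₁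
add A B (aff x₁ y₁) (aff x₂ y₂) with x₁ ≟ x₂
... | no _ =
  let s  = (y₂ - y₁) ⊘ (x₂ - x₁)
      x₃ = s * s - x₁ - x₂
  in aff x₃ (s * (x₁ - x₃) - y₁)
... | yes _ with y₁ + y₂ ≟ 0ℚ
...   | yes _ = O
...   | no _ =
  let s  = (ι (ℤ.+ 3) * x₁ * x₁ + ι A) ⊘ (ι (ℤ.+ 2) * y₁)
      x₃ = s * s - x₁ - x₂
  in aff x₃ (s * (x₁ - x₃) - y₁)

mul : ℤ → ℤ → ℕ → Pt → Pt
mul A B zero    P = O
mul A B (suc n) P = add A B (mul A B n P) P

HasOrder : ℤ → ℤ → Pt → ℕ → Set
HasOrder A B P n =
  (0 < n) × (mul A B n P ≡ O) × (∀ m → 0 < m → m < n → mul A B m P ≢ O)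
  where open import Data.Product using (_×_)

-- A point P of order 9 has [2]P, [3]P ≠ O, so an affine change of coordinates moves P to (0 , 0)
-- on a Tate normal form Y² + (1 - c) X Y - b Y = X³ - b X². There the multiples of P are computed
-- by explicit chords through (0 , 0), and [9]P = O forces Kubert's parametrisation
-- c = f² (f - 1), b = (f² - f + 1) c. Polynomial identities in the scaling w and in f then show
-- that x′ = x([3]P) is a root of the division polynomial ψ₃, that (x′ , y′) lies on the curve, and
-- that T(x , x′) = 0 for T(x , t) = (x - t) ψ₃(x)² - ψ₂ψ₄(x), the numerator of x([3]P) - t.
-- By the rational root theorem x′ is an integer (ψ₃ has leading coefficient 3, and the denominator
-- 3 is excluded modulo 9), hence so is y′, and so is x because T is monic in x. Finally x - x′
-- divides T(x , x′) - T(x′ , x′) = -(2 y′)⁶, since T(t , t) = 64 (t³ + A t + B)³ when ψ₃(t) = 0.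
module Submission where

open import Defs
open import Level using (0ℓ)
open import Algebra.Bundles.Raw using (RawRing)
open import Data.Nat.Base as ℕ using (ℕ; zero; suc)
open import Data.Integer.Base as ℤ using (ℤ; +_)
open import Data.Rational.Base as ℚ using (ℚ; 0ℚ)
open import Data.Product.Base using (proj₁; proj₂)
open import Relation.Binary.PropositionalEquality
import Data.Integer.Solver as ℤ
import Data.Rational.Solver as ℚ

cong₃ : ∀ {A B C D : Set} (f : A → B → C → D) {a a′ b b′ c c′} →
  a ≡ a′ → b ≡ b′ → c ≡ c′ → f a b c ≡ f a′ b′ c′
cong₃ f refl refl refl = refl

-- Each formula is written once over an arbitrary raw ring with numerals κ, and instantiated at ℚ
-- (ℚF), at ℤ (ℤF) and at the expression syntax of the ring solvers (ℚP, ℤP); the latter makes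
-- the identities between formulas provable by `solve`, and turns integer formulas into
-- polynomials that can be reasoned about by induction.
module Formulas (R : RawRing 0ℓ 0ℓ) (κ : ℕ → RawRing.Carrier R) where

  open RawRing R
  open import Algebra.Definitions.RawSemiring rawSemiring using (_^_)

  private
    infixl 6 _-_
    _-_ : Carrier → Carrier → Carrier
    x - y = x + - y

  tate : Carrier → Carrier → Carrier → Carrier → Carrier
  tate b c X Y = Y ^ 2 + (1# - c) * X * Y - b * Y - (X ^ 3 - b * X ^ 2)

  next-x next-y : Carrier → Carrier → Carrier → Carrier → Carrier
  next-x b c X m = m ^ 2 + (1# - c) * m + b - X
  next-y b c X m = b - (m + 1# - c) * next-x b c X m

  -- (x , y) = (36 w² (X + ((1 - c)² - 4 b) / 12) , 216 w³ (Y + ((1 - c) X - b) / 2)) maps the Tate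
  -- curve to y² = x³ + A₀ x + B₀, sending (0 , 0) to (x₀ , y₀), where the tangent has slope slope₀.
  x₀ y₀ slope₀ : Carrier → Carrier → Carrier → Carrier
  x₀ w b c = κ 3 * w ^ 2 * ((1# - c) ^ 2 - κ 4 * b)
  y₀ w b c = - (κ 108 * w ^ 3 * b)
  slope₀ w b c = κ 3 * w * (1# - c)

  A₀ B₀ : Carrier → Carrier → Carrier → Carrier
  A₀ w b c = κ 2 * slope₀ w b c * y₀ w b c - κ 3 * x₀ w b c * x₀ w b c
  B₀ w b c = y₀ w b c * y₀ w b c - x₀ w b c * x₀ w b c * x₀ w b c - A₀ w b c * x₀ w b c

  lift-x : Carrier → Carrier → Carrier → Carrier → Carrier
  lift-x w b c X = x₀ w b c + κ 36 * w ^ 2 * X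

  lift-y : Carrier → Carrier → Carrier → Carrier → Carrier → Carrier
  lift-y w b c X Y = y₀ w b c + κ 36 * slope₀ w b c * w ^ 2 * X + κ 216 * w ^ 3 * Y

  -- Kubert's family of Tate curves on which (0 , 0) has order 9.
  kubert-b kubert-c : Carrier → Carrier
  kubert-c f = f ^ 2 * (f - 1#)
  kubert-b f = (f ^ 2 - f + 1#) * kubert-c f

  -- Division polynomials of y² = x³ + A x + B in homogeneous coordinates (p : q);
  -- x([3]P) = x - ψ₂ψ₄ / ψ₃², so triplingʰ clears the denominator of x([3]P) - t.
  cubicʰ ψ₃ʰ ψ₂ψ₄ʰ : Carrier → Carrier → Carrier → Carrier → Carrier
  cubicʰ A B p q = p ^ 3 + A * p * q ^ 2 + B * q ^ 3
  ψ₃ʰ A B p q = κ 3 * p ^ 4 + κ 6 * A * p ^ 2 * q ^ 2 + κ 12 * B * p * q ^ 3 - A ^ 2 * q ^ 4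
  ψ₂ψ₄ʰ A B p q = κ 8 * cubicʰ A B p q *
    (p ^ 6 + κ 5 * A * p ^ 4 * q ^ 2 + κ 20 * B * p ^ 3 * q ^ 3 - κ 5 * A ^ 2 * p ^ 2 * q ^ 4
      - κ 4 * A * B * p * q ^ 5 - (A ^ 3 + κ 8 * B ^ 2) * q ^ 6)

  triplingʰ : Carrier → Carrier → Carrier → Carrier → Carrier → Carrier
  triplingʰ A B p q t = (p - t * q) * ψ₃ʰ A B p q ^ 2 - ψ₂ψ₄ʰ A B p q

  cubic ψ₃ : Carrier → Carrier → Carrier → Carrier
  cubic A B x = cubicʰ A B x 1#
  ψ₃ A B x = ψ₃ʰ A B x 1#

  tripling : Carrier → Carrier → Carrier → Carrier → Carrier
  tripling A B x t = triplingʰ A B x 1# t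

ℚ-polynomialRawRing : ℕ → RawRing 0ℓ 0ℓ
ℚ-polynomialRawRing n = record
  { Carrier = Polynomial n ; _≈_ = _≡_ ; _+_ = _:+_ ; _*_ = _:*_ ; -_ = :-_ ; 0# = con 0ℚ ; 1# = con ℚ.1ℚ }
  where open ℚ.+-*-Solver

ℤ-polynomialRawRing : ℕ → RawRing 0ℓ 0ℓ
ℤ-polynomialRawRing n = record
  { Carrier = Polynomial n ; _≈_ = _≡_ ; _+_ = _:+_ ; _*_ = _:*_ ; -_ = :-_ ; 0# = con (+ 0) ; 1# = con (+ 1) }
  where open ℤ.+-*-Solver

module ℚF = Formulas ℚ.+-*-rawRing (λ n → ι (+ n))
module ℤF = Formulas ℤ.+-*-rawRing +_
module ℚP {n} = Formulas (ℚ-polynomialRawRing n) (λ k → ℚ.+-*-Solver.con (ι (+ k)))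
module ℤP {n} = Formulas (ℤ-polynomialRawRing n) (λ k → ℤ.+-*-Solver.con (+ k))

module ℚ-Field where

  open import Data.Rational.Base using (_+_; _*_; _-_; 1ℚ; 1/_; ≢-nonZero)
  open import Data.Rational.Properties
    using (_≟_; *-assoc; *-comm; *-identityˡ; *-identityʳ; *-inverseˡ; *-zeroʳ; +-inverseʳ; +-identityˡ)
  open import Data.Sum.Base using (_⊎_; inj₁; inj₂)
  open import Relation.Nullary using (yes; no; contradiction)
  open ℚ.+-*-Solver
  open ≡-Reasoning

  p≡q⇒p-q≡0 : ∀ {p q} → p ≡ q → p - q ≡ 0ℚ
  p≡q⇒p-q≡0 {p} refl = +-inverseʳ p

  p-q≡0⇒p≡q : ∀ {p q} → p - q ≡ 0ℚ → p ≡ q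
  p-q≡0⇒p≡q {p} {q} p-q≡0 = begin
    p           ≡⟨ solve 2 (λ p q → p := p :- q :+ q) refl p q ⟩
    p - q + q   ≡⟨ cong (_+ q) p-q≡0 ⟩
    0ℚ + q      ≡⟨ +-identityˡ q ⟩
    q           ∎

  p⊘q*q≡p : ∀ p {q} → q ≢ 0ℚ → (p ⊘ q) * q ≡ p
  p⊘q*q≡p p {q} q≢0 with q ≟ 0ℚ
  ... | yes q≡0 = contradiction q≡0 q≢0
  ... | no q≢0 = let instance _ = ≢-nonZero q≢0 in begin
    p * 1/ q * q   ≡⟨ *-assoc p (1/ q) q ⟩
    p * (1/ q * q) ≡⟨ cong (p *_) (*-inverseˡ q) ⟩
    p * 1ℚ         ≡⟨ *-identityʳ p ⟩
    p              ∎

  p*q≡0⇒q≡0 : ∀ {p q} → p ≢ 0ℚ → p * q ≡ 0ℚ → q ≡ 0ℚ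
  p*q≡0⇒q≡0 {p} {q} p≢0 pq≡0 = let instance _ = ≢-nonZero p≢0 in begin
    q              ≡⟨ sym (*-identityˡ q) ⟩
    1ℚ * q         ≡⟨ cong (_* q) (sym (*-inverseˡ p)) ⟩
    1/ p * p * q   ≡⟨ *-assoc (1/ p) p q ⟩
    1/ p * (p * q) ≡⟨ cong (1/ p *_) pq≡0 ⟩
    1/ p * 0ℚ      ≡⟨ *-zeroʳ (1/ p) ⟩
    0ℚ             ∎

  p*q≡0⇒p≡0∨q≡0 : ∀ p q → p * q ≡ 0ℚ → p ≡ 0ℚ ⊎ q ≡ 0ℚ
  p*q≡0⇒p≡0∨q≡0 p q pq≡0 with p ≟ 0ℚ
  ... | yes p≡0 = inj₁ p≡0
  ... | no p≢0 = inj₂ (p*q≡0⇒q≡0 p≢0 pq≡0)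

  *-≢0 : ∀ {p q} → p ≢ 0ℚ → q ≢ 0ℚ → p * q ≢ 0ℚ
  *-≢0 {p} {q} p≢0 q≢0 pq≡0 = q≢0 (p*q≡0⇒q≡0 p≢0 pq≡0)

  *-cancelʳ-≡ : ∀ {p q r} → r ≢ 0ℚ → p * r ≡ q * r → p ≡ q
  *-cancelʳ-≡ {p} {q} {r} r≢0 eq = p-q≡0⇒p≡q (p*q≡0⇒q≡0 r≢0 (begin
    r * (p - q)   ≡⟨ solve 3 (λ p q r → r :* (p :- q) := p :* r :- q :* r) refl p q r ⟩
    p * r - q * r ≡⟨ p≡q⇒p-q≡0 eq ⟩
    0ℚ            ∎))

  *-cancelˡ-≡ : ∀ {p q r} → r ≢ 0ℚ → r * p ≡ r * q → p ≡ q
  *-cancelˡ-≡ {p} {q} {r} r≢0 eq =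
    *-cancelʳ-≡ r≢0 (trans (*-comm p r) (trans eq (*-comm r q)))

  ⊘-unique : ∀ {p q r} → q ≢ 0ℚ → r * q ≡ p → p ⊘ q ≡ r
  ⊘-unique {p} q≢0 eq = *-cancelʳ-≡ q≢0 (trans (p⊘q*q≡p p q≢0) (sym eq))

module IntegerEmbedding where

  open import Data.Integer.Base using (+[1+_]; -[1+_])
  open import Data.Integer.Properties using (*-identityʳ)
  open import Data.Rational.Base using (mkℚ; _+_; _*_; -_; ↥_)
  open import Data.Rational.Properties using (fromℚᵘ-toℚᵘ)
  open ≡-Reasoning
  import Data.Nat.Coprimality as Coprimality

  ι≡mkℚ : ∀ z → ι z ≡ mkℚ z 0 (Coprimality.sym (Coprimality.1-coprimeTo _))
  ι≡mkℚ z = fromℚᵘ-toℚᵘ (mkℚ z 0 _)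

  ι-injective : ∀ {i j} → ι i ≡ ι j → i ≡ j
  ι-injective {i} {j} eq = cong ↥_ (trans (sym (ι≡mkℚ i)) (trans eq (ι≡mkℚ j)))

  ι-≢0 : ∀ n .{{_ : ℕ.NonZero n}} → ι (+ n) ≢ 0ℚ
  ι-≢0 (suc n) eq with trans (sym (ι≡mkℚ (+ suc n))) eq
  ... | ()

  ι-+ : ∀ i j → ι (i ℤ.+ j) ≡ ι i + ι j
  ι-+ i j = begin
    ι (i ℤ.+ j)                 ≡⟨ cong ι (cong₂ ℤ._+_ (*-identityʳ i) (*-identityʳ j)) ⟨
    ι (i ℤ.* + 1 ℤ.+ j ℤ.* + 1) ≡⟨ unfold-+ ⟨
    ι i + ι j                   ∎
    where
    unfold-+ : ι i + ι j ≡ ι (i ℤ.* + 1 ℤ.+ j ℤ.* + 1)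
    unfold-+ rewrite ι≡mkℚ i | ι≡mkℚ j = refl

  ι-* : ∀ i j → ι (i ℤ.* j) ≡ ι i * ι j
  ι-* i j = sym unfold-*
    where
    unfold-* : ι i * ι j ≡ ι (i ℤ.* j)
    unfold-* rewrite ι≡mkℚ i | ι≡mkℚ j = refl

  ι-neg : ∀ i → ι (ℤ.- i) ≡ - ι i
  ι-neg i rewrite ι≡mkℚ i | ι≡mkℚ (ℤ.- i) = neg-mkℚ i
    where
    neg-mkℚ : ∀ i → mkℚ (ℤ.- i) 0 (Coprimality.sym (Coprimality.1-coprimeTo _))
                  ≡ - mkℚ i 0 (Coprimality.sym (Coprimality.1-coprimeTo _))
    neg-mkℚ (+ zero) = refl
    neg-mkℚ +[1+ n ] = refl
    neg-mkℚ -[1+ n ] = refl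

module ChordTangent where

  open import Data.Rational.Base using (_+_; _*_; _-_)
  open import Data.Rational.Properties using (_≟_)
  open import Data.Product.Base using (_×_; _,_)
  open import Data.Nat.Base using (_≤_; _<_; _∸_; s≤s; z≤n)
  open import Data.Nat.Properties using (m∸n+n≡m; <⇒≤; +-comm; +-monoʳ-≤)
  open import Relation.Nullary using (yes; no; contradiction)

  chord : ℚ → ℚ → ℚ → ℚ → Pt
  chord s x₁ y₁ x₂ = aff x₃ (s * (x₁ - x₃) - y₁)
    where x₃ = s * s - x₁ - x₂

  module _ (A B : ℤ) {x₁ y₁ x₂ y₂ : ℚ} where

    add-chord : x₁ ≢ x₂ →
      add A B (aff x₁ y₁) (aff x₂ y₂) ≡ chord ((y₂ - y₁) ⊘ (x₂ - x₁)) x₁ y₁ x₂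
    add-chord x₁≢x₂ with x₁ ≟ x₂
    ... | yes x₁≡x₂ = contradiction x₁≡x₂ x₁≢x₂
    ... | no _ = refl

    add-vertical : x₁ ≡ x₂ → y₁ + y₂ ≡ 0ℚ → add A B (aff x₁ y₁) (aff x₂ y₂) ≡ O
    add-vertical x₁≡x₂ y₁+y₂≡0 with x₁ ≟ x₂
    ... | no x₁≢x₂ = contradiction x₁≡x₂ x₁≢x₂
    ... | yes _ with y₁ + y₂ ≟ 0ℚ
    ...   | yes _ = refl
    ...   | no y₁+y₂≢0 = contradiction y₁+y₂≡0 y₁+y₂≢0

    add≡O⇒vertical : add A B (aff x₁ y₁) (aff x₂ y₂) ≡ O → x₁ ≡ x₂ × y₁ + y₂ ≡ 0ℚ
    add≡O⇒vertical sum≡O with x₁ ≟ x₂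
    ... | no _ = contradiction sum≡O λ ()
    ... | yes x₁≡x₂ with y₁ + y₂ ≟ 0ℚ
    ...   | yes y₁+y₂≡0 = x₁≡x₂ , y₁+y₂≡0
    ...   | no _ = contradiction sum≡O λ ()

  add-tangent : ∀ A B x y → y + y ≢ 0ℚ →
    add A B (aff x y) (aff x y) ≡ chord ((ι (+ 3) * x * x + ι A) ⊘ (ι (+ 2) * y)) x y x
  add-tangent A B x y 2y≢0 with x ≟ x
  ... | no x≢x = contradiction refl x≢x
  ... | yes _ with y + y ≟ 0ℚ
  ...   | yes 2y≡0 = contradiction 2y≡0 2y≢0
  ...   | no _ = refl

  mul-periodic : ∀ A B {k P} → mul A B k P ≡ P → ∀ j → mul A B (j ℕ.+ k) P ≡ mul A B (suc j) P
  mul-periodic A B [k]P≡P zero = [k]P≡P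
  mul-periodic A B {P = P} [k]P≡P (suc j) = cong (λ Q → add A B Q P) (mul-periodic A B [k]P≡P j)

  [k]P≢P : ∀ A B {P n k} → HasOrder A B P n → 2 ≤ k → k < n → mul A B k P ≢ P
  [k]P≢P A B {P} {n} {k} (_ , [n]P≡O , minimal) 2≤k k<n [k]P≡P =
    minimal (suc j) (s≤s z≤n) 1+j<n (begin
      mul A B (suc j) P   ≡⟨ mul-periodic A B [k]P≡P j ⟨
      mul A B (j ℕ.+ k) P ≡⟨ cong (λ m → mul A B m P) j+k≡n ⟩
      mul A B n P         ≡⟨ [n]P≡O ⟩
      O                   ∎)
    where
    open ≡-Reasoning
    j = n ∸ k
    j+k≡n : j ℕ.+ k ≡ n
    j+k≡n = m∸n+n≡m (<⇒≤ k<n)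
    1+j<n : suc j < n
    1+j<n = subst (suc (suc j) ≤_) j+k≡n (subst (_≤ j ℕ.+ k) (+-comm j 2) (+-monoʳ-≤ j 2≤k))

module TateNormalForm where

  open import Data.Rational.Base using (_+_; _*_; _-_; -_)
  open import Data.Rational.Properties using (*-comm; *-zeroʳ; neg-injective)
  open import Data.Product.Base using (_×_; _,_)
  open ℚ.+-*-Solver
  open ℚ-Field
  open IntegerEmbedding using (ι-≢0)
  open ChordTangent
  open ℚF
  open ≡-Reasoning

  OnTate : ℚ → ℚ → ℚ × ℚ → Set
  OnTate b c (X , Y) = tate b c X Y ≡ 0ℚ

  -- (X , Y) + (0 , 0) on the Tate curve: reflection of the third point on the line Y = m X.
  next : ℚ → ℚ → ℚ × ℚ → ℚ × ℚ
  next b c (X , Y) = next-x b c X m , next-y b c X m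
    where m = Y ⊘ X

  -- orbit b c n is [n + 2]P in Tate coordinates, starting from [2]P = (b , b c).
  orbit : ℚ → ℚ → ℕ → ℚ × ℚ
  orbit b c zero = b , b * c
  orbit b c (suc n) = next b c (orbit b c n)

  vieta : ∀ b c {X m} → X ≢ 0ℚ → tate b c X (m * X) ≡ 0ℚ → X * next-x b c X m ≡ b * m
  vieta b c {X} {m} X≢0 on = p-q≡0⇒p≡q (p*q≡0⇒q≡0 X≢0 (trans (sym (factor b c X m)) on))
    where
    factor : ∀ b c X m → tate b c X (m * X) ≡ X * (X * next-x b c X m - b * m)
    factor = solve 4 (λ b c X m →
      ℚP.tate b c X (m :* X) := X :* (X :* ℚP.next-x b c X m :- b :* m)) refl

  next-onTate : ∀ b c {X Y} → X ≢ 0ℚ → OnTate b c (X , Y) → OnTate b c (next b c (X , Y))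
  next-onTate b c {X} {Y} X≢0 on = begin
    tate b c X′ (next-y b c X m)  ≡⟨ factor b c X m ⟩
    X′ * (X * X′ - b * m)         ≡⟨ cong (X′ *_) (p≡q⇒p-q≡0 (vieta b c X≢0 on′)) ⟩
    X′ * 0ℚ                       ≡⟨ *-zeroʳ X′ ⟩
    0ℚ                            ∎
    where
    m = Y ⊘ X
    X′ = next-x b c X m
    on′ : tate b c X (m * X) ≡ 0ℚ
    on′ = subst (λ Y → tate b c X Y ≡ 0ℚ) (sym (p⊘q*q≡p Y X≢0)) on
    factor : ∀ b c X m →
      tate b c (next-x b c X m) (next-y b c X m) ≡ next-x b c X m * (X * next-x b c X m - b * m)
    factor = solve 4 (λ b c X m → ℚP.tate b c (ℚP.next-x b c X m) (ℚP.next-y b c X m)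
      := ℚP.next-x b c X m :* (X :* ℚP.next-x b c X m :- b :* m)) refl

  tate-X≡0 : ∀ b c Y → tate b c 0ℚ Y ≡ Y * (Y - b)
  tate-X≡0 = solve 3 (λ b c Y → ℚP.tate b c (con 0ℚ) Y := Y :* (Y :- b)) refl

  orbit-0-onTate : ∀ b c → OnTate b c (orbit b c 0)
  orbit-0-onTate = solve 2 (λ b c → ℚP.tate b c b (b :* c) := con 0ℚ) refl

  orbit-1 : ∀ {b} c → b ≢ 0ℚ → orbit b c 1 ≡ (c , b - c)
  orbit-1 {b} c b≢0 = cong₂ _,_
    (trans (cong (next-x b c b) m≡c) (next-x≡c b c))
    (trans (cong (next-y b c b) m≡c) (next-y≡b-c b c))
    where
    m≡c : (b * c) ⊘ b ≡ c
    m≡c = ⊘-unique b≢0 (*-comm c b)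
    next-x≡c : ∀ b c → next-x b c b c ≡ c
    next-x≡c = solve 2 (λ b c → ℚP.next-x b c b c := c) refl
    next-y≡b-c : ∀ b c → next-y b c b c ≡ b - c
    next-y≡b-c = solve 2 (λ b c → ℚP.next-y b c b c := b :- c) refl

  module TateCoordinates (A B : ℤ) (w b c : ℚ) where

    P : Pt
    P = aff (x₀ w b c) (y₀ w b c)

    lift : ℚ × ℚ → Pt
    lift (X , Y) = aff (lift-x w b c X) (lift-y w b c X Y)

    private
      36w²≢0 : w ≢ 0ℚ → ι (+ 36) * w * w ≢ 0ℚ
      36w²≢0 w≢0 = *-≢0 (*-≢0 (ι-≢0 36) w≢0) w≢0

      lift-x-x₀ : ∀ w b c X → lift-x w b c X - x₀ w b c ≡ ι (+ 36) * w * w * X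
      lift-x-x₀ = solve 4 (λ w b c X →
        ℚP.lift-x w b c X :- ℚP.x₀ w b c := con (ι (+ 36)) :* w :* w :* X) refl

      lift-x-0 : ∀ w b c → lift-x w b c 0ℚ ≡ x₀ w b c
      lift-x-0 = solve 3 (λ w b c → ℚP.lift-x w b c (con 0ℚ) := ℚP.x₀ w b c) refl

    lift-0-0 : lift (0ℚ , 0ℚ) ≡ P
    lift-0-0 = cong₂ aff (lift-x-0 w b c) (lift-y-0-0 w b c)
      where
      lift-y-0-0 : ∀ w b c → lift-y w b c 0ℚ 0ℚ ≡ y₀ w b c
      lift-y-0-0 = solve 3 (λ w b c → ℚP.lift-y w b c (con 0ℚ) (con 0ℚ) := ℚP.y₀ w b c) refl

    lift-0-b+P≡O : add A B (lift (0ℚ , b)) P ≡ O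
    lift-0-b+P≡O = add-vertical A B (lift-x-0 w b c) (lift-y-0-b w b c)
      where
      lift-y-0-b : ∀ w b c → lift-y w b c 0ℚ b + y₀ w b c ≡ 0ℚ
      lift-y-0-b = solve 3 (λ w b c → ℚP.lift-y w b c (con 0ℚ) b :+ ℚP.y₀ w b c := con 0ℚ) refl

    lift+P≡O⇒X≡0 : ∀ {X Y} → w ≢ 0ℚ → add A B (lift (X , Y)) P ≡ O → X ≡ 0ℚ
    lift+P≡O⇒X≡0 {X} {Y} w≢0 sum≡O = p*q≡0⇒q≡0 (36w²≢0 w≢0) (begin
      ι (+ 36) * w * w * X      ≡⟨ lift-x-x₀ w b c X ⟨
      lift-x w b c X - x₀ w b c ≡⟨ p≡q⇒p-q≡0 (proj₁ vertical) ⟩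
      0ℚ                        ∎)
      where
      vertical = add≡O⇒vertical A B {lift-x w b c X} {lift-y w b c X Y} {x₀ w b c} {y₀ w b c} sum≡O

    lift+P : ∀ {X Y} → w ≢ 0ℚ → X ≢ 0ℚ → add A B (lift (X , Y)) P ≡ lift (next b c (X , Y))
    lift+P {X} {Y} w≢0 X≢0 = begin
      add A B (lift (X , Y)) P
        ≡⟨ cong (λ Y → add A B (lift (X , Y)) P) (sym (p⊘q*q≡p Y X≢0)) ⟩
      add A B (lift (X , m * X)) P
        ≡⟨ add-chord A B x≢x₀ ⟩
      chord ((y₀ w b c - lift-y w b c X (m * X)) ⊘ (x₀ w b c - lift-x w b c X))
            (lift-x w b c X) (lift-y w b c X (m * X)) (x₀ w b c)
        ≡⟨ cong (λ s → chord s (lift-x w b c X) (lift-y w b c X (m * X)) (x₀ w b c)) slope≡ ⟩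
      chord (slope₀ w b c + ι (+ 6) * w * m) (lift-x w b c X) (lift-y w b c X (m * X)) (x₀ w b c)
        ≡⟨ cong₂ aff (chord-x w b c X m) (chord-y w b c X m) ⟩
      lift (next b c (X , Y))
        ∎
      where
      m = Y ⊘ X
      x≢x₀ : lift-x w b c X ≢ x₀ w b c
      x≢x₀ x≡x₀ = *-≢0 (36w²≢0 w≢0) X≢0 (trans (sym (lift-x-x₀ w b c X)) (p≡q⇒p-q≡0 x≡x₀))
      slope-identity : ∀ w b c X m → (slope₀ w b c + ι (+ 6) * w * m) * (x₀ w b c - lift-x w b c X)
        ≡ y₀ w b c - lift-y w b c X (m * X)
      slope-identity = solve 5 (λ w b c X m →
        (ℚP.slope₀ w b c :+ con (ι (+ 6)) :* w :* m) :* (ℚP.x₀ w b c :- ℚP.lift-x w b c X)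
        := ℚP.y₀ w b c :- ℚP.lift-y w b c X (m :* X)) refl
      slope≡ : (y₀ w b c - lift-y w b c X (m * X)) ⊘ (x₀ w b c - lift-x w b c X)
        ≡ slope₀ w b c + ι (+ 6) * w * m
      slope≡ = ⊘-unique (λ x₀-x≡0 → x≢x₀ (sym (p-q≡0⇒p≡q x₀-x≡0)))
        (slope-identity w b c X m)
      chord-x : ∀ w b c X m → let s = slope₀ w b c + ι (+ 6) * w * m in
        s * s - lift-x w b c X - x₀ w b c ≡ lift-x w b c (next-x b c X m)
      chord-x = solve 5 (λ w b c X m → let s = ℚP.slope₀ w b c :+ con (ι (+ 6)) :* w :* m in
        s :* s :- ℚP.lift-x w b c X :- ℚP.x₀ w b c := ℚP.lift-x w b c (ℚP.next-x b c X m)) refl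
      chord-y : ∀ w b c X m → let s = slope₀ w b c + ι (+ 6) * w * m in
        s * (lift-x w b c X - (s * s - lift-x w b c X - x₀ w b c)) - lift-y w b c X (m * X)
        ≡ lift-y w b c (next-x b c X m) (next-y b c X m)
      chord-y = solve 5 (λ w b c X m → let s = ℚP.slope₀ w b c :+ con (ι (+ 6)) :* w :* m in
        s :* (ℚP.lift-x w b c X :- (s :* s :- ℚP.lift-x w b c X :- ℚP.x₀ w b c)) :- ℚP.lift-y w b c X (m :* X)
        := ℚP.lift-y w b c (ℚP.next-x b c X m) (ℚP.next-y b c X m)) refl

    double-P : w ≢ 0ℚ → b ≢ 0ℚ → ι A ≡ A₀ w b c → add A B P P ≡ lift (b , b * c)
    double-P w≢0 b≢0 A≡A₀ = begin
      add A B P P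
        ≡⟨ add-tangent A B (x₀ w b c) (y₀ w b c) 2y₀≢0 ⟩
      chord ((ι (+ 3) * x₀ w b c * x₀ w b c + ι A) ⊘ (ι (+ 2) * y₀ w b c)) (x₀ w b c) (y₀ w b c) (x₀ w b c)
        ≡⟨ cong (λ s → chord s (x₀ w b c) (y₀ w b c) (x₀ w b c)) tangent≡slope₀ ⟩
      chord (slope₀ w b c) (x₀ w b c) (y₀ w b c) (x₀ w b c)
        ≡⟨ cong₂ aff (tangent-x w b c) (tangent-y w b c) ⟩
      lift (b , b * c)
        ∎
      where
      2y₀-identity : ∀ w b c → y₀ w b c + y₀ w b c ≡ - (ι (+ 216) * w * w * w * b)
      2y₀-identity = solve 3 (λ w b c →
        ℚP.y₀ w b c :+ ℚP.y₀ w b c := :- (con (ι (+ 216)) :* w :* w :* w :* b)) refl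
      2y₀≢0 : y₀ w b c + y₀ w b c ≢ 0ℚ
      2y₀≢0 2y₀≡0 = *-≢0 (*-≢0 (*-≢0 (*-≢0 (ι-≢0 216) w≢0) w≢0) w≢0) b≢0
        (neg-injective (trans (sym (2y₀-identity w b c)) 2y₀≡0))
      y₀≢0 : y₀ w b c ≢ 0ℚ
      y₀≢0 y₀≡0 = 2y₀≢0 (cong₂ _+_ y₀≡0 y₀≡0)
      slope-identity : ∀ w b c →
        slope₀ w b c * (ι (+ 2) * y₀ w b c) ≡ ι (+ 3) * x₀ w b c * x₀ w b c + A₀ w b c
      slope-identity = solve 3 (λ w b c → ℚP.slope₀ w b c :* (con (ι (+ 2)) :* ℚP.y₀ w b c)
        := con (ι (+ 3)) :* ℚP.x₀ w b c :* ℚP.x₀ w b c :+ ℚP.A₀ w b c) refl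
      tangent≡slope₀ : (ι (+ 3) * x₀ w b c * x₀ w b c + ι A) ⊘ (ι (+ 2) * y₀ w b c) ≡ slope₀ w b c
      tangent≡slope₀ = ⊘-unique (*-≢0 (ι-≢0 2) y₀≢0)
        (trans (slope-identity w b c) (cong (λ a → ι (+ 3) * x₀ w b c * x₀ w b c + a) (sym A≡A₀)))
      tangent-x : ∀ w b c → slope₀ w b c * slope₀ w b c - x₀ w b c - x₀ w b c ≡ lift-x w b c b
      tangent-x = solve 3 (λ w b c →
        ℚP.slope₀ w b c :* ℚP.slope₀ w b c :- ℚP.x₀ w b c :- ℚP.x₀ w b c := ℚP.lift-x w b c b) refl
      tangent-y : ∀ w b c → let s = slope₀ w b c in
        s * (x₀ w b c - (s * s - x₀ w b c - x₀ w b c)) - y₀ w b c ≡ lift-y w b c b (b * c)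
      tangent-y = solve 3 (λ w b c → let s = ℚP.slope₀ w b c in
        s :* (ℚP.x₀ w b c :- (s :* s :- ℚP.x₀ w b c :- ℚP.x₀ w b c)) :- ℚP.y₀ w b c
        := ℚP.lift-y w b c b (b :* c)) refl

record TateForm (A B : ℤ) (x y : ℚ) : Set where
  open ℚF
  field
    w b c : ℚ
    w≢0 : w ≢ 0ℚ
    b≢0 : b ≢ 0ℚ
    x≡x₀ : x ≡ x₀ w b c
    y≡y₀ : y ≡ y₀ w b c
    A≡A₀ : ι A ≡ A₀ w b c
    B≡B₀ : ι B ≡ B₀ w b c

-- Any point P with [2]P, [3]P ≠ O is (0 , 0) on a Tate curve: w, b, c are solved from
-- slope₀ = λ (the tangent slope at P), x₀ = x and y₀ = y.
module TateNormalisation (A B : ℤ) {x y : ℚ} (on-curve : onCurve A B x y)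
  ([2]P≢O : mul A B 2 (aff x y) ≢ O) ([3]P≢O : mul A B 3 (aff x y) ≢ O) where

  open import Data.Rational.Base using (_+_; _*_; _-_; -_; 1ℚ)
  open import Data.Rational.Properties using (*-zeroˡ; *-zeroʳ; neg-injective)
  open ℚ.+-*-Solver
  open ℚ-Field
  open IntegerEmbedding using (ι-≢0)
  open ChordTangent
  open ℚF using (x₀; y₀; slope₀; A₀; B₀)
  open ≡-Reasoning

  private
    2y≢0 : y + y ≢ 0ℚ
    2y≢0 2y≡0 = [2]P≢O (add-vertical A B {x} {y} {x} {y} refl 2y≡0)

    y≢0 : y ≢ 0ℚ
    y≢0 y≡0 = 2y≢0 (cong₂ _+_ y≡0 y≡0)

    slope : ℚ
    slope = (ι (+ 3) * x * x + ι A) ⊘ (ι (+ 2) * y)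

    slope*2y : slope * (ι (+ 2) * y) ≡ ι (+ 3) * x * x + ι A
    slope*2y = p⊘q*q≡p _ (*-≢0 (ι-≢0 2) y≢0)

    δ : ℚ
    δ = ι (+ 3) * x - slope * slope

    -- δ = 0 would give x([2]P) = x, so [2]P = -P.
    δ≢0 : δ ≢ 0ℚ
    δ≢0 δ≡0 = [3]P≢O (trans (cong (λ Q → add A B Q (aff x y)) (add-tangent A B x y 2y≢0))
      (add-vertical A B {x₂} {y₂} {x} {y} x₂≡x y₂+y≡0))
      where
      x₂ = slope * slope - x - x
      y₂ = slope * (x - x₂) - y
      x₂≡x : x₂ ≡ x
      x₂≡x = p-q≡0⇒p≡q (begin
        x₂ - x   ≡⟨ solve 2 (λ s x → s :* s :- x :- x :- x := :- (con (ι (+ 3)) :* x :- s :* s)) refl slope x ⟩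
        - δ      ≡⟨ cong -_ δ≡0 ⟩
        0ℚ       ∎)
      y₂+y≡0 : y₂ + y ≡ 0ℚ
      y₂+y≡0 = begin
        y₂ + y               ≡⟨ solve 3 (λ s x y → s :* (x :- (s :* s :- x :- x)) :- y :+ y
                                  := s :* (x :- (s :* s :- x :- x))) refl slope x y ⟩
        slope * (x - x₂)     ≡⟨ cong (slope *_) (p≡q⇒p-q≡0 (sym x₂≡x)) ⟩
        slope * 0ℚ           ≡⟨ *-zeroʳ slope ⟩
        0ℚ                   ∎

    w α β b c : ℚ
    w = y ⊘ (ι (+ 3) * δ)
    α = slope ⊘ (ι (+ 3) * w)
    β = δ ⊘ (ι (+ 36) * w * w)
    b = - β
    c = 1ℚ - α

    w*3δ≡y : w * (ι (+ 3) * δ) ≡ y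
    w*3δ≡y = p⊘q*q≡p y (*-≢0 (ι-≢0 3) δ≢0)

    w≢0 : w ≢ 0ℚ
    w≢0 w≡0 = y≢0 (trans (sym w*3δ≡y) (trans (cong (_* (ι (+ 3) * δ)) w≡0) (*-zeroˡ (ι (+ 3) * δ))))

    α*3w≡slope : α * (ι (+ 3) * w) ≡ slope
    α*3w≡slope = p⊘q*q≡p slope (*-≢0 (ι-≢0 3) w≢0)

    β*36w²≡δ : β * (ι (+ 36) * w * w) ≡ δ
    β*36w²≡δ = p⊘q*q≡p δ (*-≢0 (*-≢0 (ι-≢0 36) w≢0) w≢0)

    b≢0 : b ≢ 0ℚ
    b≢0 b≡0 = δ≢0 (trans (sym β*36w²≡δ)
      (trans (cong (_* (ι (+ 36) * w * w)) (neg-injective {β} {0ℚ} b≡0)) (*-zeroˡ (ι (+ 36) * w * w))))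

    slope₀≡slope : slope₀ w b c ≡ slope
    slope₀≡slope = trans
      (solve 3 (λ w α β → ℚP.slope₀ w (:- β) (con 1ℚ :- α) := α :* (con (ι (+ 3)) :* w)) refl w α β)
      α*3w≡slope

    x₀≡x : x₀ w b c ≡ x
    x₀≡x = *-cancelˡ-≡ (ι-≢0 3) (begin
      ι (+ 3) * x₀ w b c
        ≡⟨ solve 3 (λ w α β → con (ι (+ 3)) :* ℚP.x₀ w (:- β) (con 1ℚ :- α)
             := α :* (con (ι (+ 3)) :* w) :* (α :* (con (ι (+ 3)) :* w)) :+ β :* (con (ι (+ 36)) :* w :* w))
             refl w α β ⟩
      α * (ι (+ 3) * w) * (α * (ι (+ 3) * w)) + β * (ι (+ 36) * w * w)
        ≡⟨ cong₂ (λ s d → s * s + d) α*3w≡slope β*36w²≡δ ⟩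
      slope * slope + δ
        ≡⟨ solve 2 (λ s x → s :* s :+ (con (ι (+ 3)) :* x :- s :* s) := con (ι (+ 3)) :* x) refl slope x ⟩
      ι (+ 3) * x
        ∎)

    y₀≡y : y₀ w b c ≡ y
    y₀≡y = begin
      y₀ w b c
        ≡⟨ solve 3 (λ w β c → ℚP.y₀ w (:- β) c := w :* (con (ι (+ 3)) :* (β :* (con (ι (+ 36)) :* w :* w))))
             refl w β c ⟩
      w * (ι (+ 3) * (β * (ι (+ 36) * w * w)))
        ≡⟨ cong (λ d → w * (ι (+ 3) * d)) β*36w²≡δ ⟩
      w * (ι (+ 3) * δ)
        ≡⟨ w*3δ≡y ⟩
      y ∎

    A≡A₀ : ι A ≡ A₀ w b c
    A≡A₀ = begin
      ι A                                       ≡⟨ solve 2 (λ a t → a := t :+ a :- t)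
                                                      refl (ι A) (ι (+ 3) * x * x) ⟩
      ι (+ 3) * x * x + ι A - ι (+ 3) * x * x   ≡⟨ cong (_- ι (+ 3) * x * x) slope*2y ⟨
      slope * (ι (+ 2) * y) - ι (+ 3) * x * x   ≡⟨ solve 3 (λ s y t → s :* (con (ι (+ 2)) :* y) :- t
                                                    := con (ι (+ 2)) :* s :* y :- t) refl slope y (ι (+ 3) * x * x) ⟩
      ι (+ 2) * slope * y - ι (+ 3) * x * x     ≡⟨ cong₃ (λ s x y → ι (+ 2) * s * y - ι (+ 3) * x * x)
                                                      slope₀≡slope x₀≡x y₀≡y ⟨
      A₀ w b c                                  ∎

    B≡B₀ : ι B ≡ B₀ w b c
    B≡B₀ = begin
      ι B                                   ≡⟨ solve 2 (λ B t → B := t :+ B :- t)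
                                                  refl (ι B) (x * x * x + ι A * x) ⟩
      x * x * x + ι A * x + ι B - (x * x * x + ι A * x)  ≡⟨ cong (_- (x * x * x + ι A * x)) on-curve ⟨
      y * y - (x * x * x + ι A * x)         ≡⟨ solve 3 (λ x y a → y :* y :- (x :* x :* x :+ a :* x)
                                                := y :* y :- x :* x :* x :- a :* x) refl x y (ι A) ⟩
      y * y - x * x * x - ι A * x           ≡⟨ cong₃ (λ x y a → y * y - x * x * x - a * x)
                                                  x₀≡x y₀≡y (sym A≡A₀) ⟨
      B₀ w b c                              ∎

  tate-form : TateForm A B x y
  tate-form = record
    { w = w ; b = b ; c = c ; w≢0 = w≢0 ; b≢0 = b≢0
    ; x≡x₀ = sym x₀≡x ; y≡y₀ = sym y₀≡y ; A≡A₀ = A≡A₀ ; B≡B₀ = B≡B₀ }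

-- Read backwards from X₆ = 0 (that is, [8]P = -P) and forwards from [2]P, the orbit pins down
-- X₂ and X₃ in terms of r = b / c; comparing both readings at step 2 gives Kubert's curve.
module KubertParametrisation (b c : ℚ) (b≢0 : b ≢ 0ℚ)
  (X≢0 : ∀ n → n ℕ.≤ 5 → proj₁ (TateNormalForm.orbit b c n) ≢ 0ℚ)
  (onTate : ∀ n → n ℕ.≤ 5 → TateNormalForm.OnTate b c (TateNormalForm.orbit b c n))
  (X₆≡0 : proj₁ (TateNormalForm.orbit b c 6) ≡ 0ℚ) where

  open import Data.Rational.Base using (_+_; _*_; _-_; 1ℚ)
  open import Data.Rational.Properties using (*-comm; *-zeroˡ; *-zeroʳ)
  open import Data.Nat.Base using (_≤_)
  open import Data.Nat.Properties using (m≤m+n; ≤-refl)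
  open import Data.Product.Base using (Σ; _×_; _,_)
  open ℚ.+-*-Solver
  open ℚ-Field
  open TateNormalForm
  open ℚF using (tate; next-x; next-y; kubert-b; kubert-c)
  open ≡-Reasoning

  private
    X Y m : ℕ → ℚ
    X n = proj₁ (orbit b c n)
    Y n = proj₂ (orbit b c n)
    m n = Y n ⊘ X n

    m*X≡Y : ∀ n → n ≤ 5 → m n * X n ≡ Y n
    m*X≡Y n n≤5 = p⊘q*q≡p (Y n) (X≢0 n n≤5)

    X*X′≡b*m : ∀ n → n ≤ 5 → X n * X (suc n) ≡ b * m n
    X*X′≡b*m n n≤5 = vieta b c (X≢0 n n≤5)
      (subst (λ Y → tate b c (X n) Y ≡ 0ℚ) (sym (m*X≡Y n n≤5)) (onTate n n≤5))

    X₁≡c : X 1 ≡ c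
    X₁≡c = cong proj₁ (orbit-1 c b≢0)

    Y₁≡b-c : Y 1 ≡ b - c
    Y₁≡b-c = cong proj₂ (orbit-1 c b≢0)

    c≢0 : c ≢ 0ℚ
    c≢0 c≡0 = X≢0 1 (m≤m+n 1 4) (trans X₁≡c c≡0)

    r : ℚ
    r = b ⊘ c

    r*c≡b : r * c ≡ b
    r*c≡b = p⊘q*q≡p b c≢0

    b-c≡[r-1]*c : b - c ≡ (r - 1ℚ) * c
    b-c≡[r-1]*c = begin
      b - c         ≡⟨ cong (_- c) r*c≡b ⟨
      r * c - c     ≡⟨ solve 2 (λ r c → r :* c :- c := (r :- con 1ℚ) :* c) refl r c ⟩
      (r - 1ℚ) * c  ∎

    m₁≡r-1 : m 1 ≡ r - 1ℚ
    m₁≡r-1 = *-cancelʳ-≡ c≢0 (begin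
      m 1 * c       ≡⟨ cong (m 1 *_) X₁≡c ⟨
      m 1 * X 1     ≡⟨ m*X≡Y 1 (m≤m+n 1 4) ⟩
      Y 1           ≡⟨ Y₁≡b-c ⟩
      b - c         ≡⟨ b-c≡[r-1]*c ⟩
      (r - 1ℚ) * c  ∎)

    X₂≡r[r-1] : X 2 ≡ r * (r - 1ℚ)
    X₂≡r[r-1] = begin
      next-x b c (X 1) (m 1)          ≡⟨ cong₂ (next-x b c) X₁≡c m₁≡r-1 ⟩
      next-x b c c (r - 1ℚ)           ≡⟨ cong (λ b → next-x b c c (r - 1ℚ)) r*c≡b ⟨
      next-x (r * c) c c (r - 1ℚ)     ≡⟨ solve 2 (λ r c → ℚP.next-x (r :* c) c c (r :- con 1ℚ)
                                           := r :* (r :- con 1ℚ)) refl r c ⟩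
      r * (r - 1ℚ)                    ∎

    Y₂≡ : Y 2 ≡ r * c - (r - c) * (r * (r - 1ℚ))
    Y₂≡ = begin
      next-y b c (X 1) (m 1)          ≡⟨ cong₂ (next-y b c) X₁≡c m₁≡r-1 ⟩
      next-y b c c (r - 1ℚ)           ≡⟨ cong (λ b → next-y b c c (r - 1ℚ)) r*c≡b ⟨
      next-y (r * c) c c (r - 1ℚ)     ≡⟨ solve 2 (λ r c → ℚP.next-y (r :* c) c c (r :- con 1ℚ)
                                           := r :* c :- (r :- c) :* (r :* (r :- con 1ℚ))) refl r c ⟩
      r * c - (r - c) * (r * (r - 1ℚ)) ∎

    m₅≡0 : m 5 ≡ 0ℚ
    m₅≡0 = p*q≡0⇒q≡0 b≢0 (begin
      b * m 5    ≡⟨ X*X′≡b*m 5 ≤-refl ⟨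
      X 5 * X 6  ≡⟨ cong (X 5 *_) X₆≡0 ⟩
      X 5 * 0ℚ   ≡⟨ *-zeroʳ (X 5) ⟩
      0ℚ         ∎)

    X₅≡b : X 5 ≡ b
    X₅≡b = sym (p-q≡0⇒p≡q (begin
      b - X 5              ≡⟨ solve 3 (λ b c X → ℚP.next-x b c X (con 0ℚ) := b :- X) refl b c (X 5) ⟨
      next-x b c (X 5) 0ℚ  ≡⟨ cong (next-x b c (X 5)) m₅≡0 ⟨
      X 6                  ≡⟨ X₆≡0 ⟩
      0ℚ                   ∎))

    Y₅≡0 : Y 5 ≡ 0ℚ
    Y₅≡0 = trans (sym (m*X≡Y 5 ≤-refl)) (trans (cong (_* X 5) m₅≡0) (*-zeroˡ (X 5)))

    X₄≡m₄ : X 4 ≡ m 4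
    X₄≡m₄ = *-cancelʳ-≡ b≢0 (begin
      X 4 * b    ≡⟨ cong (X 4 *_) X₅≡b ⟨
      X 4 * X 5  ≡⟨ X*X′≡b*m 4 (m≤m+n 4 1) ⟩
      b * m 4    ≡⟨ *-comm b (m 4) ⟩
      m 4 * b    ∎)

    m₄≡c : m 4 ≡ c
    m₄≡c = sym (p-q≡0⇒p≡q (p*q≡0⇒q≡0 b≢0 (begin
      b * (c - m 4)             ≡⟨ solve 3 (λ b c m → b :* (c :- m) := b :- (m :+ con 1ℚ :- c) :* b)
                                     refl b c (m 4) ⟩
      b - (m 4 + 1ℚ - c) * b    ≡⟨ cong (λ x → b - (m 4 + 1ℚ - c) * x) X₅≡b ⟨
      b - (m 4 + 1ℚ - c) * X 5  ≡⟨⟩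
      Y 5                       ≡⟨ Y₅≡0 ⟩
      0ℚ                        ∎)))

    X₄≡c : X 4 ≡ c
    X₄≡c = trans X₄≡m₄ m₄≡c

    m₃≡r-1 : m 3 ≡ r - 1ℚ
    m₃≡r-1 = *-cancelʳ-≡ c≢0 (begin
      m 3 * c       ≡⟨ p-q≡0⇒p≡q b-c-m₃c≡0 ⟨
      b - c         ≡⟨ b-c≡[r-1]*c ⟩
      (r - 1ℚ) * c  ∎)
      where
      Y₄≡c*c : b - (m 3 + 1ℚ - c) * c ≡ c * c
      Y₄≡c*c = begin
        b - (m 3 + 1ℚ - c) * c    ≡⟨ cong (λ x → b - (m 3 + 1ℚ - c) * x) X₄≡c ⟨
        Y 4                       ≡⟨ m*X≡Y 4 (m≤m+n 4 1) ⟨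
        m 4 * X 4                 ≡⟨ cong₂ _*_ m₄≡c X₄≡c ⟩
        c * c                     ∎
      b-c-m₃c≡0 : b - c - m 3 * c ≡ 0ℚ
      b-c-m₃c≡0 = begin
        b - c - m 3 * c                    ≡⟨ solve 3 (λ b c m → b :- c :- m :* c
                                                := b :- (m :+ con 1ℚ :- c) :* c :- c :* c) refl b c (m 3) ⟩
        b - (m 3 + 1ℚ - c) * c - c * c     ≡⟨ p≡q⇒p-q≡0 Y₄≡c*c ⟩
        0ℚ                                 ∎

    X₃≡r[r-1] : X 3 ≡ r * (r - 1ℚ)
    X₃≡r[r-1] = *-cancelʳ-≡ c≢0 (begin
      X 3 * c           ≡⟨ cong (X 3 *_) X₄≡c ⟨
      X 3 * X 4         ≡⟨ X*X′≡b*m 3 (m≤m+n 3 2) ⟩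
      b * m 3           ≡⟨ cong₂ _*_ r*c≡b (sym m₃≡r-1) ⟨
      r * c * (r - 1ℚ)  ≡⟨ solve 2 (λ r c → r :* c :* (r :- con 1ℚ) := r :* (r :- con 1ℚ) :* c) refl r c ⟩
      r * (r - 1ℚ) * c  ∎)

    r[r-1]≢0 : r * (r - 1ℚ) ≢ 0ℚ
    r[r-1]≢0 r[r-1]≡0 = X≢0 2 (m≤m+n 2 3) (trans X₂≡r[r-1] r[r-1]≡0)

    r≢0 : r ≢ 0ℚ
    r≢0 r≡0 = r[r-1]≢0 (trans (cong (_* (r - 1ℚ)) r≡0) (*-zeroˡ (r - 1ℚ)))

    r-1≢0 : r - 1ℚ ≢ 0ℚ
    r-1≢0 r-1≡0 = r[r-1]≢0 (trans (cong (r *_) r-1≡0) (*-zeroʳ r))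

    c*Y₂≡ : c * (r * c - (r - c) * (r * (r - 1ℚ))) ≡ r * (r - 1ℚ) * (r - 1ℚ) * (r * (r - 1ℚ))
    c*Y₂≡ = begin
      c * (r * c - (r - c) * (r * (r - 1ℚ)))  ≡⟨ cong (c *_) (trans (m*X≡Y 2 (m≤m+n 2 3)) Y₂≡) ⟨
      c * (m 2 * X 2)                         ≡⟨ solve 3 (λ c m X → c :* (m :* X) := c :* m :* X)
                                                   refl c (m 2) (X 2) ⟩
      c * m 2 * X 2                           ≡⟨ cong₂ _*_ c*m₂≡ X₂≡r[r-1] ⟩
      r * (r - 1ℚ) * (r - 1ℚ) * (r * (r - 1ℚ)) ∎
      where
      c*m₂≡ : c * m 2 ≡ r * (r - 1ℚ) * (r - 1ℚ)
      c*m₂≡ = *-cancelˡ-≡ r≢0 (begin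
        r * (c * m 2)                    ≡⟨ solve 3 (λ r c m → r :* (c :* m) := r :* c :* m) refl r c (m 2) ⟩
        r * c * m 2                      ≡⟨ cong (_* m 2) r*c≡b ⟩
        b * m 2                          ≡⟨ X*X′≡b*m 2 (m≤m+n 2 3) ⟨
        X 2 * X 3                        ≡⟨ cong₂ _*_ X₂≡r[r-1] X₃≡r[r-1] ⟩
        r * (r - 1ℚ) * (r * (r - 1ℚ))    ≡⟨ solve 1 (λ r → r :* (r :- con 1ℚ) :* (r :* (r :- con 1ℚ))
                                               := r :* (r :* (r :- con 1ℚ) :* (r :- con 1ℚ))) refl r ⟩
        r * (r * (r - 1ℚ) * (r - 1ℚ))    ∎)

    f : ℚ
    f = c ⊘ (r - 1ℚ)

    f*[r-1]≡c : f * (r - 1ℚ) ≡ c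
    f*[r-1]≡c = p⊘q*q≡p c r-1≢0

    r≡f²-f+1 : r ≡ f * f - f + 1ℚ
    r≡f²-f+1 = sym (p-q≡0⇒p≡q (p*q≡0⇒q≡0 r²[r-1]²≢0 (begin
      r * r * (r - 1ℚ) * (r - 1ℚ) * (f * f - f + 1ℚ - r)
        ≡⟨ factor r f ⟨
      equation (f * (r - 1ℚ))
        ≡⟨ cong equation f*[r-1]≡c ⟩
      equation c
        ≡⟨ p≡q⇒p-q≡0 c*Y₂≡ ⟩
      0ℚ ∎)))
      where
      equation : ℚ → ℚ
      equation c = c * (r * c - (r - c) * (r * (r - 1ℚ))) - r * (r - 1ℚ) * (r - 1ℚ) * (r * (r - 1ℚ))
      factor : ∀ r f → let c = f * (r - 1ℚ) in
        c * (r * c - (r - c) * (r * (r - 1ℚ))) - r * (r - 1ℚ) * (r - 1ℚ) * (r * (r - 1ℚ))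
        ≡ r * r * (r - 1ℚ) * (r - 1ℚ) * (f * f - f + 1ℚ - r)
      factor = solve 2 (λ r f → let c = f :* (r :- con 1ℚ) in
        c :* (r :* c :- (r :- c) :* (r :* (r :- con 1ℚ)))
          :- r :* (r :- con 1ℚ) :* (r :- con 1ℚ) :* (r :* (r :- con 1ℚ))
        := r :* r :* (r :- con 1ℚ) :* (r :- con 1ℚ) :* (f :* f :- f :+ con 1ℚ :- r)) refl
      r²[r-1]²≢0 : r * r * (r - 1ℚ) * (r - 1ℚ) ≢ 0ℚ
      r²[r-1]²≢0 = *-≢0 (*-≢0 (*-≢0 r≢0 r≢0) r-1≢0) r-1≢0

  kubert : Σ ℚ λ f → b ≡ kubert-b f × c ≡ kubert-c f
  kubert = f , b≡kubert-b , c≡kubert-c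
    where
    c≡kubert-c : c ≡ kubert-c f
    c≡kubert-c = begin
      c                            ≡⟨ f*[r-1]≡c ⟨
      f * (r - 1ℚ)                 ≡⟨ cong (λ r → f * (r - 1ℚ)) r≡f²-f+1 ⟩
      f * (f * f - f + 1ℚ - 1ℚ)    ≡⟨ solve 1 (λ f → f :* (f :* f :- f :+ con 1ℚ :- con 1ℚ) := ℚP.kubert-c f)
                                        refl f ⟩
      kubert-c f                   ∎
    b≡kubert-b : b ≡ kubert-b f
    b≡kubert-b = begin
      b                            ≡⟨ r*c≡b ⟨
      r * c                        ≡⟨ cong₂ _*_ r≡f²-f+1 c≡kubert-c ⟩
      (f * f - f + 1ℚ) * kubert-c f ≡⟨ solve 1 (λ f → (f :* f :- f :+ con 1ℚ) :* ℚP.kubert-c f := ℚP.kubert-b f)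
                                        refl f ⟩
      kubert-b f                   ∎

module OrbitOfOrderNine (A B : ℤ) (w b c : ℚ) (w≢0 : w ≢ 0ℚ) (b≢0 : b ≢ 0ℚ)
  (A≡A₀ : ι A ≡ ℚF.A₀ w b c)
  (order : HasOrder A B (TateNormalForm.TateCoordinates.P A B w b c) 9) where

  open import Data.Rational.Base using (_-_)
  open import Data.Nat.Base using (_≤_; s≤s; z≤n)
  open import Data.Nat.Properties using (m≤n⇒m≤1+n; ≤-refl)
  open import Data.Product.Base using (Σ; _×_; _,_)
  open import Data.Sum.Base using ([_,_]′)
  open import Function.Base using (_∘_)
  open ℚ-Field
  open ChordTangent
  open TateNormalForm
  open TateCoordinates A B w b c
  open ℚF using (tate; kubert-b; kubert-c)

  private
    -- X = 0 forces Y ∈ {0 , b}, that is [k]P = P or [k + 1]P = O.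
    X≢0 : ∀ {k X Y} → 2 ≤ k → k ≤ 7 → mul A B k P ≡ lift (X , Y) → OnTate b c (X , Y) → X ≢ 0ℚ
    X≢0 {k} {X} {Y} 2≤k k≤7 [k]P≡ on X≡0 =
      [ [k]P≢P A B {P} {9} order 2≤k (s≤s (m≤n⇒m≤1+n k≤7)) ∘ [k]P≡P
      , proj₂ (proj₂ order) (suc k) (s≤s z≤n) (s≤s (s≤s k≤7)) ∘ [k+1]P≡O
      ]′ (p*q≡0⇒p≡0∨q≡0 Y (Y - b)
           (trans (sym (tate-X≡0 b c Y)) (subst (λ X → tate b c X Y ≡ 0ℚ) X≡0 on)))
      where
      [k]P≡P : Y ≡ 0ℚ → mul A B k P ≡ P
      [k]P≡P Y≡0 = trans [k]P≡ (trans (cong lift (cong₂ _,_ X≡0 Y≡0)) lift-0-0)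
      [k+1]P≡O : Y - b ≡ 0ℚ → add A B (mul A B k P) P ≡ O
      [k+1]P≡O Y-b≡0 = trans
        (cong (λ Q → add A B Q P) (trans [k]P≡ (cong lift (cong₂ _,_ X≡0 (p-q≡0⇒p≡q Y-b≡0)))))
        lift-0-b+P≡O

    orbit-multiple : ∀ n → n ≤ 6 → mul A B (2 ℕ.+ n) P ≡ lift (orbit b c n) × OnTate b c (orbit b c n)
    orbit-multiple zero _ = double-P w≢0 b≢0 A≡A₀ , orbit-0-onTate b c
    orbit-multiple (suc n) (s≤s n≤5) =
      trans (cong (λ Q → add A B Q P) [2+n]P≡) (lift+P w≢0 X≢0′) , next-onTate b c X≢0′ on
      where
      [2+n]P≡ = proj₁ (orbit-multiple n (m≤n⇒m≤1+n n≤5))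
      on = proj₂ (orbit-multiple n (m≤n⇒m≤1+n n≤5))
      X≢0′ : proj₁ (orbit b c n) ≢ 0ℚ
      X≢0′ = X≢0 (s≤s (s≤s z≤n)) (s≤s (s≤s n≤5)) [2+n]P≡ on

    orbit-X≢0 : ∀ n → n ≤ 5 → proj₁ (orbit b c n) ≢ 0ℚ
    orbit-X≢0 n n≤5 = X≢0 (s≤s (s≤s z≤n)) (s≤s (s≤s n≤5)) (proj₁ multiple) (proj₂ multiple)
      where multiple = orbit-multiple n (m≤n⇒m≤1+n n≤5)

    orbit-X₆≡0 : proj₁ (orbit b c 6) ≡ 0ℚ
    orbit-X₆≡0 = lift+P≡O⇒X≡0 w≢0
      (trans (cong (λ Q → add A B Q P) (sym (proj₁ (orbit-multiple 6 ≤-refl)))) (proj₁ (proj₂ order)))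

  [3]P≡lift[c,b-c] : mul A B 3 P ≡ lift (c , b - c)
  [3]P≡lift[c,b-c] = trans (proj₁ (orbit-multiple 1 (s≤s z≤n))) (cong lift (orbit-1 c b≢0))

  kubert-parameter : Σ ℚ λ f → b ≡ kubert-b f × c ≡ kubert-c f
  kubert-parameter = KubertParametrisation.kubert b c b≢0 orbit-X≢0
    (λ n n≤5 → proj₂ (orbit-multiple n (m≤n⇒m≤1+n n≤5))) orbit-X₆≡0

record TriplingRelations (A B : ℤ) (x x′ y′ : ℚ) : Set where
  open ℚF
  field
    ψ₃-root : ψ₃ (ι A) (ι B) x′ ≡ 0ℚ
    on-curve : y′ ℚ.* y′ ≡ cubic (ι A) (ι B) x′
    tripling-root : tripling (ι A) (ι B) x x′ ≡ 0ℚ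

module TriplingOfOrderNine where

  open import Data.Rational.Base using (_*_; _-_)
  open import Data.Nat.Base using (s≤s; z≤n)
  open import Data.Nat.Properties using (m≤m+n)
  open import Data.Product.Base using (Σ; _×_; _,_)
  open ℚ.+-*-Solver
  open TateNormalForm
  open ℚF

  ψ₃-at-third-multiple : ∀ w f → let b = kubert-b f ; c = kubert-c f in
    ψ₃ (A₀ w b c) (B₀ w b c) (lift-x w b c c) ≡ 0ℚ
  ψ₃-at-third-multiple = solve 2 (λ w f → let b = ℚP.kubert-b f ; c = ℚP.kubert-c f in
    ℚP.ψ₃ (ℚP.A₀ w b c) (ℚP.B₀ w b c) (ℚP.lift-x w b c c) := con 0ℚ) refl

  third-multiple-on-curve : ∀ w b c → let y = lift-y w b c c (b - c) in
    y * y ≡ cubic (A₀ w b c) (B₀ w b c) (lift-x w b c c)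
  third-multiple-on-curve = solve 3 (λ w b c → let y = ℚP.lift-y w b c c (b :- c) in
    y :* y := ℚP.cubic (ℚP.A₀ w b c) (ℚP.B₀ w b c) (ℚP.lift-x w b c c)) refl

  tripling-at-third-multiple : ∀ w b c → tripling (A₀ w b c) (B₀ w b c) (x₀ w b c) (lift-x w b c c) ≡ 0ℚ
  tripling-at-third-multiple = solve 3 (λ w b c →
    ℚP.tripling (ℚP.A₀ w b c) (ℚP.B₀ w b c) (ℚP.x₀ w b c) (ℚP.lift-x w b c c) := con 0ℚ) refl

  third-multiple-relations : ∀ A B w b c → ι A ≡ A₀ w b c → ι B ≡ B₀ w b c →
    Σ ℚ (λ f → b ≡ kubert-b f × c ≡ kubert-c f) →
    TriplingRelations A B (x₀ w b c) (lift-x w b c c) (lift-y w b c c (b - c))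
  third-multiple-relations A B w b c A≡A₀ B≡B₀ (f , b≡ , c≡) = record
    { ψ₃-root = trans (cong₂ (λ A B → ψ₃ A B x′) A≡A₀ B≡B₀)
        (subst₂ (λ b c → ψ₃ (A₀ w b c) (B₀ w b c) (lift-x w b c c) ≡ 0ℚ) (sym b≡) (sym c≡)
          (ψ₃-at-third-multiple w f))
    ; on-curve = trans (third-multiple-on-curve w b c) (sym (cong₂ (λ A B → cubic A B x′) A≡A₀ B≡B₀))
    ; tripling-root = trans (cong₂ (λ A B → tripling A B (x₀ w b c) x′) A≡A₀ B≡B₀)
        (tripling-at-third-multiple w b c)
    }
    where x′ = lift-x w b c c

  private
    aff-injective : ∀ {x y x′ y′} → aff x y ≡ aff x′ y′ → x ≡ x′ × y ≡ y′
    aff-injective refl = refl , refl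

    subst-relations : ∀ {A B x x′ y′ X X′ Y′} → x ≡ X → x′ ≡ X′ → y′ ≡ Y′ →
      TriplingRelations A B X X′ Y′ → TriplingRelations A B x x′ y′
    subst-relations refl refl refl relations = relations

  order-9⇒tripling-relations : ∀ A B {x y x′ y′} → onCurve A B x y → HasOrder A B (aff x y) 9 →
    mul A B 3 (aff x y) ≡ aff x′ y′ → TriplingRelations A B x x′ y′
  order-9⇒tripling-relations A B {x} {y} {x′} {y′} on-curve order [3]P≡ =
    subst-relations x≡x₀ (proj₁ third-multiple) (proj₂ third-multiple)
      (third-multiple-relations A B w b c A≡A₀ B≡B₀ kubert-parameter)
    where
    [k]P≢O : ∀ k → 0 ℕ.< k → k ℕ.< 9 → mul A B k (aff x y) ≢ O
    [k]P≢O = proj₂ (proj₂ order)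
    open TateForm (TateNormalisation.tate-form A B {x} {y} on-curve
      ([k]P≢O 2 (s≤s z≤n) (m≤m+n 3 6)) ([k]P≢O 3 (s≤s z≤n) (m≤m+n 4 5)))
    open TateCoordinates A B w b c
    P≡P₀ : aff x y ≡ P
    P≡P₀ = cong₂ aff x≡x₀ y≡y₀
    open OrbitOfOrderNine A B w b c w≢0 b≢0 A≡A₀ (subst (λ Q → HasOrder A B Q 9) P≡P₀ order)
    third-multiple : x′ ≡ lift-x w b c c × y′ ≡ lift-y w b c c (b - c)
    third-multiple = aff-injective (trans (sym [3]P≡) (trans (cong (mul A B 3) P≡P₀) [3]P≡lift[c,b-c]))

module IntegerPolynomials where

  open import Algebra.Definitions.RawSemiring ℚ.+-*-rawSemiring using () renaming (_^_ to _ℚ^_)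
  open import Data.Integer.Base using (_+_; _*_; _-_; -_)
  open import Data.Integer.Properties using (+-inverseʳ; *-zeroˡ)
  open import Data.Integer.Divisibility.Signed
    using (_∣_; divides; ∣-refl; ∣m∣n⇒∣m+n; ∣m⇒∣-m; ∣n⇒∣m*n)
  open import Data.Integer.Tactic.RingSolver using (solve-∀)
  open import Data.Fin.Base using (zero; suc)
  open import Data.Vec.Base using (Vec; _∷_; lookup; map)
  open import Data.Vec.Properties using (lookup-map)
  open ℤ.+-*-Solver using (Polynomial; op; con; var; _:^_; :-_; [+]; [*]; ⟦_⟧)
  open IntegerEmbedding

  ⟦_⟧ℚ : ∀ {n} → Polynomial n → Vec ℚ n → ℚ
  ⟦ op [+] p q ⟧ℚ ρ = ⟦ p ⟧ℚ ρ ℚ.+ ⟦ q ⟧ℚ ρ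
  ⟦ op [*] p q ⟧ℚ ρ = ⟦ p ⟧ℚ ρ ℚ.* ⟦ q ⟧ℚ ρ
  ⟦ con c ⟧ℚ ρ = ι c
  ⟦ var i ⟧ℚ ρ = lookup ρ i
  ⟦ p :^ k ⟧ℚ ρ = ⟦ p ⟧ℚ ρ ℚ^ k
  ⟦ :- p ⟧ℚ ρ = ℚ.- ⟦ p ⟧ℚ ρ

  ι-⟦⟧ : ∀ {n} (p : Polynomial n) (ρ : Vec ℤ n) → ι (⟦ p ⟧ ρ) ≡ ⟦ p ⟧ℚ (map ι ρ)
  ι-⟦⟧ (op [+] p q) ρ = trans (ι-+ (⟦ p ⟧ ρ) (⟦ q ⟧ ρ)) (cong₂ ℚ._+_ (ι-⟦⟧ p ρ) (ι-⟦⟧ q ρ))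
  ι-⟦⟧ (op [*] p q) ρ = trans (ι-* (⟦ p ⟧ ρ) (⟦ q ⟧ ρ)) (cong₂ ℚ._*_ (ι-⟦⟧ p ρ) (ι-⟦⟧ q ρ))
  ι-⟦⟧ (con c) ρ = refl
  ι-⟦⟧ (var i) ρ = sym (lookup-map i ι ρ)
  ι-⟦⟧ (p :^ k) ρ = ι-^ k
    where
    ι-^ : ∀ k → ι (⟦ p :^ k ⟧ ρ) ≡ ⟦ p :^ k ⟧ℚ (map ι ρ)
    ι-^ zero = refl
    ι-^ (suc k) = trans (ι-* (⟦ p ⟧ ρ) (⟦ p :^ k ⟧ ρ)) (cong₂ ℚ._*_ (ι-⟦⟧ p ρ) (ι-^ k))
  ι-⟦⟧ (:- p) ρ = trans (ι-neg (⟦ p ⟧ ρ)) (cong ℚ.-_ (ι-⟦⟧ p ρ))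

  private
    ∣-refl-difference : ∀ d x → d ∣ x - x
    ∣-refl-difference d x = divides (+ 0) (trans (+-inverseʳ x) (sym (*-zeroˡ d)))

    ∣-+-difference : ∀ {d} x x′ y y′ → d ∣ x - x′ → d ∣ y - y′ → d ∣ (x + y) - (x′ + y′)
    ∣-+-difference {d} x x′ y y′ dx dy =
      subst (d ∣_) (rearrange x x′ y y′) (∣m∣n⇒∣m+n dx dy)
      where
      rearrange : ∀ x x′ y y′ → (x - x′) + (y - y′) ≡ (x + y) - (x′ + y′)
      rearrange = solve-∀

    ∣-*-difference : ∀ {d} x x′ y y′ → d ∣ x - x′ → d ∣ y - y′ → d ∣ x * y - x′ * y′
    ∣-*-difference {d} x x′ y y′ dx dy =
      subst (d ∣_) (rearrange x x′ y y′) (∣m∣n⇒∣m+n (∣n⇒∣m*n x dy) (∣n⇒∣m*n y′ dx))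
      where
      rearrange : ∀ x x′ y y′ → x * (y - y′) + y′ * (x - x′) ≡ x * y - x′ * y′
      rearrange = solve-∀

    ∣-neg-difference : ∀ {d} x x′ → d ∣ x - x′ → d ∣ - x - - x′
    ∣-neg-difference {d} x x′ dx = subst (d ∣_) (rearrange x x′) (∣m⇒∣-m dx)
      where
      rearrange : ∀ x x′ → - (x - x′) ≡ - x - - x′
      rearrange = solve-∀

  ι-⟦⟧-injective : ∀ {n} (p : Polynomial n) (ρ : Vec ℤ n) {z} →
    ⟦ p ⟧ℚ (map ι ρ) ≡ ι z → ⟦ p ⟧ ρ ≡ z
  ι-⟦⟧-injective p ρ eq = ι-injective (trans (ι-⟦⟧ p ρ) eq)

  a-b∣p[a]-p[b] : ∀ {n} (p : Polynomial (suc n)) a b (ρ : Vec ℤ n) →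
    (a - b) ∣ ⟦ p ⟧ (a ∷ ρ) - ⟦ p ⟧ (b ∷ ρ)
  a-b∣p[a]-p[b] (op [+] p q) a b ρ =
    ∣-+-difference (⟦ p ⟧ (a ∷ ρ)) (⟦ p ⟧ (b ∷ ρ)) (⟦ q ⟧ (a ∷ ρ)) (⟦ q ⟧ (b ∷ ρ))
      (a-b∣p[a]-p[b] p a b ρ) (a-b∣p[a]-p[b] q a b ρ)
  a-b∣p[a]-p[b] (op [*] p q) a b ρ =
    ∣-*-difference (⟦ p ⟧ (a ∷ ρ)) (⟦ p ⟧ (b ∷ ρ)) (⟦ q ⟧ (a ∷ ρ)) (⟦ q ⟧ (b ∷ ρ))
      (a-b∣p[a]-p[b] p a b ρ) (a-b∣p[a]-p[b] q a b ρ)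
  a-b∣p[a]-p[b] (con c) a b ρ = ∣-refl-difference (a - b) c
  a-b∣p[a]-p[b] (var zero) a b ρ = ∣-refl
  a-b∣p[a]-p[b] (var (suc i)) a b ρ = ∣-refl-difference (a - b) (lookup ρ i)
  a-b∣p[a]-p[b] (p :^ k) a b ρ = ∣-^ k
    where
    ∣-^ : ∀ k → (a - b) ∣ ⟦ p :^ k ⟧ (a ∷ ρ) - ⟦ p :^ k ⟧ (b ∷ ρ)
    ∣-^ zero = ∣-refl-difference (a - b) (+ 1)
    ∣-^ (suc k) =
      ∣-*-difference (⟦ p ⟧ (a ∷ ρ)) (⟦ p ⟧ (b ∷ ρ)) (⟦ p :^ k ⟧ (a ∷ ρ)) (⟦ p :^ k ⟧ (b ∷ ρ))
        (a-b∣p[a]-p[b] p a b ρ) (∣-^ k)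
  a-b∣p[a]-p[b] (:- p) a b ρ = ∣-neg-difference (⟦ p ⟧ (a ∷ ρ)) (⟦ p ⟧ (b ∷ ρ)) (a-b∣p[a]-p[b] p a b ρ)

module RationalRoots where

  open import Data.Integer.Base using (_+_; _*_; _-_; -_; _^_; ∣_∣)
  open import Data.Integer.Properties using (*-identityˡ; *-identityʳ; *-assoc; abs-*; neg-involutive; +-identityˡ)
  open import Data.Integer.Divisibility.Signed using (_∣_; ∣ᵤ⇒∣; ∣⇒∣ᵤ; ∣m⇒∣-m)
  open import Data.Nat.Coprimality as Coprimality using (Coprime; coprime-divisor)
  open import Data.Nat.Divisibility using () renaming (_∣_ to _∣ℕ_)
  import Data.Nat.Properties as ℕₚ
  open import Data.Rational.Base using (mkℚ; ↥_; ↧_; ↧ₙ_; toℚᵘ)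
  open import Data.Rational.Properties using (toℚᵘ-injective; toℚᵘ-homo-*)
  import Data.Rational.Unnormalised.Base as ℚᵘ
  import Data.Rational.Unnormalised.Properties as ℚᵘ
  open import Data.Vec.Base using (Vec; _∷_; map)
  open ℤ.+-*-Solver using (Polynomial; ⟦_⟧)
  open IntegerEmbedding
  open IntegerPolynomials

  lowest-terms : ∀ x → Coprime (↧ₙ x) ∣ ↥ x ∣
  lowest-terms (mkℚ _ _ coprime) = Coprimality.sym (Coprimality.recompute coprime)

  x*↧x≡↥x : ∀ x → x ℚ.* ι (↧ x) ≡ ι (↥ x)
  x*↧x≡↥x x@(mkℚ p d _) = toℚᵘ-injective (begin
    toℚᵘ (x ℚ.* ι (+ suc d))              ≈⟨ toℚᵘ-homo-* x (ι (+ suc d)) ⟩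
    toℚᵘ x ℚᵘ.* toℚᵘ (ι (+ suc d))         ≡⟨ cong (λ z → toℚᵘ x ℚᵘ.* toℚᵘ z) (ι≡mkℚ (+ suc d)) ⟩
    ℚᵘ.mkℚᵘ p d ℚᵘ.* ℚᵘ.mkℚᵘ (+ suc d) 0   ≈⟨ ℚᵘ.*≡* cross-multiplied ⟩
    ℚᵘ.mkℚᵘ p 0                            ≡⟨ cong toℚᵘ (ι≡mkℚ p) ⟨
    toℚᵘ (ι p)                             ∎)
    where
    open ℚᵘ.≃-Reasoning
    cross-multiplied : (p * + suc d) * + 1 ≡ p * + suc (d ℕ.* 1)
    cross-multiplied rewrite ℕₚ.*-identityʳ d = *-identityʳ _

  clear-denominator : ∀ {n} (H : Polynomial (2 ℕ.+ n)) (ρ : Vec ℤ n) x →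
    ⟦ H ⟧ℚ (ι (↧ x) ∷ x ℚ.* ι (↧ x) ∷ map ι ρ) ≡ 0ℚ → ⟦ H ⟧ (↧ x ∷ ↥ x ∷ ρ) ≡ + 0
  clear-denominator H ρ x H≡0 = ι-⟦⟧-injective H (↧ x ∷ ↥ x ∷ ρ) (begin
    ⟦ H ⟧ℚ (ι (↧ x) ∷ ι (↥ x) ∷ map ι ρ)      ≡⟨ cong (λ p → ⟦ H ⟧ℚ (ι (↧ x) ∷ p ∷ map ι ρ)) (x*↧x≡↥x x) ⟨
    ⟦ H ⟧ℚ (ι (↧ x) ∷ x ℚ.* ι (↧ x) ∷ map ι ρ) ≡⟨ H≡0 ⟩
    0ℚ                                       ∎)
    where open ≡-Reasoning

  coprime-divisor-* : ∀ {q} p n → Coprime q ∣ p ∣ → + q ∣ p * n → + q ∣ n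
  coprime-divisor-* {q} p n q⊥p q∣pn =
    ∣ᵤ⇒∣ (coprime-divisor q⊥p (subst (q ∣ℕ_) (abs-* p n) (∣⇒∣ᵤ q∣pn)))

  coprime-divisor-^ : ∀ {q} p k m → Coprime q ∣ p ∣ → + q ∣ p ^ k * m → + q ∣ m
  coprime-divisor-^ {q} p zero m _ q∣m = subst (+ q ∣_) (*-identityˡ m) q∣m
  coprime-divisor-^ {q} p (suc k) m q⊥p q∣ = coprime-divisor-^ p k m q⊥p
    (coprime-divisor-* p (p ^ k * m) q⊥p (subst (+ q ∣_) (*-assoc p (p ^ k) m) q∣))

  -- H is the homogenisation, in (q , p), of a polynomial of degree k with leading coefficient lead:
  -- the denominator q of a root p / q in lowest terms divides lead.
  denominator∣leading : ∀ {n} (H : Polynomial (2 ℕ.+ n)) (ρ : Vec ℤ n) k lead q p → Coprime q ∣ p ∣ →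
    (∀ p → ⟦ H ⟧ (+ 0 ∷ p ∷ ρ) ≡ p ^ k * lead) → ⟦ H ⟧ (+ q ∷ p ∷ ρ) ≡ + 0 → + q ∣ lead
  denominator∣leading H ρ k lead q p q⊥p leading root =
    coprime-divisor-^ p k lead q⊥p
      (subst₂ _∣_ (q-0≡q q) difference (∣m⇒∣-m (a-b∣p[a]-p[b] H (+ q) (+ 0) (p ∷ ρ))))
    where
    q-0≡q : ∀ q → + q - + 0 ≡ + q
    q-0≡q q = cong +_ (ℕₚ.+-identityʳ q)
    difference : - (⟦ H ⟧ (+ q ∷ p ∷ ρ) - ⟦ H ⟧ (+ 0 ∷ p ∷ ρ)) ≡ p ^ k * lead
    difference = begin
      - (⟦ H ⟧ (+ q ∷ p ∷ ρ) - ⟦ H ⟧ (+ 0 ∷ p ∷ ρ)) ≡⟨ cong₂ (λ r l → - (r - l)) root (leading p) ⟩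
      - (+ 0 - p ^ k * lead)                       ≡⟨ cong -_ (+-identityˡ (- (p ^ k * lead))) ⟩
      - - (p ^ k * lead)                           ≡⟨ neg-involutive (p ^ k * lead) ⟩
      p ^ k * lead                                 ∎
      where open ≡-Reasoning

module Homogenisation where

  open import Data.Rational.Base using (_*_; _-_)
  open import Algebra.Definitions.RawSemiring ℚ.+-*-rawSemiring using (_^_)
  open ℚ.+-*-Solver
  open ℚF using (ψ₃ʰ; ψ₃; triplingʰ; tripling)

  ψ₃ʰ-homogeneous : ∀ A B x q → ψ₃ʰ A B (x * q) q ≡ q ^ 4 * ψ₃ A B x
  ψ₃ʰ-homogeneous = solve 4 (λ A B x q → ℚP.ψ₃ʰ A B (x :* q) q := q :^ 4 :* ℚP.ψ₃ A B x) refl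

  triplingʰ-homogeneous : ∀ A B x q t → triplingʰ A B (x * q) q t ≡ q ^ 9 * tripling A B x t
  triplingʰ-homogeneous = solve 5 (λ A B x q t →
    ℚP.triplingʰ A B (x :* q) q t := q :^ 9 :* ℚP.tripling A B x t) refl

  square-homogeneous : ∀ N y q → (y * q) * (y * q) - N * (q * q) ≡ q ^ 2 * (y * y - N)
  square-homogeneous = solve 3 (λ N y q → (y :* q) :* (y :* q) :- N :* (q :* q) := q :^ 2 :* (y :* y :- N)) refl

module IntegralCoordinates where

  open import Algebra.Definitions.RawSemiring ℚ.+-*-rawSemiring using () renaming (_^_ to _ℚ^_)
  open import Data.Empty using (⊥-elim)
  open import Data.Fin using (#_)
  open import Data.Integer.Base using (_+_; _*_; _-_; -_; _^_; ∣_∣)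
  open import Data.Integer.Divisibility using () renaming (_∣_ to _∣ᵤ_)
  open import Data.Integer.Divisibility.Signed using (_∣_; divides; ∣⇒∣ᵤ; ∣m⇒∣-m)
  open import Data.Integer.Properties using (+-identityˡ; neg-involutive; *-cancelˡ-≡)
  open import Data.Integer.Tactic.RingSolver using (solve-∀)
  open import Data.Nat.Base using (s≤s)
  open import Data.Nat.Coprimality using (Coprime)
  open import Data.Nat.Divisibility using (∣1⇒≡1; ∣⇒≤) renaming (_∣?_ to _∣ℕ?_)
  open import Data.Product.Base using (Σ; _×_; _,_)
  open import Data.Rational.Base using (mkℚ; ↥_; ↧_; ↧ₙ_)
  open import Data.Rational.Properties using (*-zeroʳ)
  open import Data.Vec.Base using (_∷_; [])
  open import Relation.Nullary using (¬_)
  open import Relation.Nullary.Decidable using (toWitnessFalse)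
  open ℤ.+-*-Solver
  open IntegerEmbedding
  open IntegerPolynomials
  open RationalRoots
  open Homogenisation
  open ≡-Reasoning

  -- The homogeneous forms have variables (q , p , A , B , t), as denominator∣leading expects.
  ψ₃ʰ-form : Polynomial 4
  ψ₃ʰ-form = ℤP.ψ₃ʰ (var (# 2)) (var (# 3)) (var (# 1)) (var (# 0))

  triplingʰ-form : Polynomial 5
  triplingʰ-form = ℤP.triplingʰ (var (# 2)) (var (# 3)) (var (# 1)) (var (# 0)) (var (# 4))

  squareʰ-form : Polynomial 3
  squareʰ-form = var (# 1) :* var (# 1) :- var (# 2) :* (var (# 0) :* var (# 0))

  denominator≡1⇒integral : ∀ x → ↧ₙ x ≡ 1 → x ≡ ι (↥ x)
  denominator≡1⇒integral (mkℚ p zero _) _ = sym (ι≡mkℚ p)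
  denominator≡1⇒integral (mkℚ p (suc d) _) ()

  denominator∣1⇒integral : ∀ x → + ↧ₙ x ∣ + 1 → x ≡ ι (↥ x)
  denominator∣1⇒integral x q∣1 = denominator≡1⇒integral x (∣1⇒≡1 (∣⇒∣ᵤ q∣1))

  square-integral : ∀ N y → y ℚ.* y ≡ ι N → y ≡ ι (↥ y)
  square-integral N y y²≡N = denominator∣1⇒integral y
    (denominator∣leading squareʰ-form (N ∷ []) 2 (+ 1) (↧ₙ y) (↥ y) (lowest-terms y) leading
      (clear-denominator squareʰ-form (N ∷ []) y (begin
        (y ℚ.* q) ℚ.* (y ℚ.* q) ℚ.- ι N ℚ.* (q ℚ.* q) ≡⟨ square-homogeneous (ι N) y q ⟩
        q ℚ^ 2 ℚ.* (y ℚ.* y ℚ.- ι N)                  ≡⟨ cong (q ℚ^ 2 ℚ.*_) (ℚ-Field.p≡q⇒p-q≡0 y²≡N) ⟩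
        q ℚ^ 2 ℚ.* 0ℚ                                 ≡⟨ *-zeroʳ (q ℚ^ 2) ⟩
        0ℚ                                            ∎)))
    where
    q = ι (↧ y)
    leading : ∀ s → s * s - N * (+ 0 * + 0) ≡ s ^ 2 * + 1
    leading = solve 2 (λ N s → s :* s :- N :* (con (+ 0) :* con (+ 0)) := s :^ 2 :* con (+ 1)) refl N

  tripling-root-integral : ∀ A B t x → ℚF.tripling (ι A) (ι B) x (ι t) ≡ 0ℚ → x ≡ ι (↥ x)
  tripling-root-integral A B t x root = denominator∣1⇒integral x
    (denominator∣leading triplingʰ-form (A ∷ B ∷ t ∷ []) 9 (+ 1) (↧ₙ x) (↥ x) (lowest-terms x) leading
      (clear-denominator triplingʰ-form (A ∷ B ∷ t ∷ []) x (begin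
        ℚF.triplingʰ (ι A) (ι B) (x ℚ.* q) q (ι t)  ≡⟨ triplingʰ-homogeneous (ι A) (ι B) x q (ι t) ⟩
        q ℚ^ 9 ℚ.* ℚF.tripling (ι A) (ι B) x (ι t)  ≡⟨ cong (q ℚ^ 9 ℚ.*_) root ⟩
        q ℚ^ 9 ℚ.* 0ℚ                               ≡⟨ *-zeroʳ (q ℚ^ 9) ⟩
        0ℚ                                          ∎)))
    where
    q = ι (↧ x)
    leading : ∀ p → ℤF.triplingʰ A B p (+ 0) t ≡ p ^ 9 * + 1
    leading = solve 4 (λ A B t p → ℤP.triplingʰ A B p (con (+ 0)) t := p :^ 9 :* con (+ 1)) refl A B t

  -- a denominator 3 would make 9 divide 3 p⁴
  ψ₃ʰ-denominator≡1 : ∀ A B x → Coprime (↧ₙ x) ∣ ↥ x ∣ → ℤF.ψ₃ʰ A B (↥ x) (↧ x) ≡ + 0 →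
    + ↧ₙ x ∣ + 3 → ↧ₙ x ≡ 1
  ψ₃ʰ-denominator≡1 A B (mkℚ p 0 _) _ _ _ = refl
  ψ₃ʰ-denominator≡1 A B (mkℚ p 1 _) _ _ 2∣3 = ⊥-elim (toWitnessFalse {a? = 2 ∣ℕ? 3} _ (∣⇒∣ᵤ 2∣3))
  ψ₃ʰ-denominator≡1 A B (mkℚ p 2 _) 3⊥p root _ =
    ⊥-elim (3≢1 (∣1⇒≡1 (∣⇒∣ᵤ (coprime-divisor-^ p 4 (+ 1) 3⊥p 3∣p⁴))))
    where
    3≢1 : 3 ≢ 1
    3≢1 ()
    K = + 6 * A * p * p + + 36 * B * p - + 9 * A * A
    at-3 : ∀ A B p →
      ℤF.ψ₃ʰ A B p (+ 3) ≡ + 3 * (p ^ 4 * + 1 + + 3 * (+ 6 * A * p * p + + 36 * B * p - + 9 * A * A))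
    at-3 = solve 3 (λ A B p → ℤP.ψ₃ʰ A B p (con (+ 3)) := con (+ 3) :* (p :^ 4 :* con (+ 1)
      :+ con (+ 3) :* (con (+ 6) :* A :* p :* p :+ con (+ 36) :* B :* p :- con (+ 9) :* A :* A))) refl
    rearrange : ∀ a K → a ≡ (a + + 3 * K) + - K * + 3
    rearrange = solve-∀
    3∣p⁴ : + 3 ∣ p ^ 4 * + 1
    3∣p⁴ = divides (- K) (begin
      p ^ 4 * + 1                         ≡⟨ rearrange (p ^ 4 * + 1) K ⟩
      (p ^ 4 * + 1 + + 3 * K) + - K * + 3 ≡⟨ cong (_+ - K * + 3)
                                               (*-cancelˡ-≡ (+ 3) _ (+ 0) (trans (sym (at-3 A B p)) root)) ⟩
      + 0 + - K * + 3                     ≡⟨ +-identityˡ (- K * + 3) ⟩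
      - K * + 3                           ∎)
  ψ₃ʰ-denominator≡1 A B (mkℚ p (suc (suc (suc d))) _) _ _ q∣3 = ⊥-elim (4+d≰3 (∣⇒≤ (∣⇒∣ᵤ q∣3)))
    where
    4+d≰3 : ¬ suc (suc (suc (suc d))) ℕ.≤ 3
    4+d≰3 (s≤s (s≤s (s≤s ())))

  ψ₃-root-integral : ∀ A B x → ℚF.ψ₃ (ι A) (ι B) x ≡ 0ℚ → x ≡ ι (↥ x)
  ψ₃-root-integral A B x root = denominator≡1⇒integral x (ψ₃ʰ-denominator≡1 A B x (lowest-terms x) root-ℤ
    (denominator∣leading ψ₃ʰ-form (A ∷ B ∷ []) 4 (+ 3) (↧ₙ x) (↥ x) (lowest-terms x) leading root-ℤ))
    where
    q = ι (↧ x)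
    root-ℤ : ℤF.ψ₃ʰ A B (↥ x) (↧ x) ≡ + 0
    root-ℤ = clear-denominator ψ₃ʰ-form (A ∷ B ∷ []) x (begin
      ℚF.ψ₃ʰ (ι A) (ι B) (x ℚ.* q) q  ≡⟨ ψ₃ʰ-homogeneous (ι A) (ι B) x q ⟩
      q ℚ^ 4 ℚ.* ℚF.ψ₃ (ι A) (ι B) x  ≡⟨ cong (q ℚ^ 4 ℚ.*_) root ⟩
      q ℚ^ 4 ℚ.* 0ℚ                   ≡⟨ *-zeroʳ (q ℚ^ 4) ⟩
      0ℚ                              ∎)
    leading : ∀ p → ℤF.ψ₃ʰ A B p (+ 0) ≡ p ^ 4 * + 3
    leading = solve 3 (λ A B p → ℤP.ψ₃ʰ A B p (con (+ 0)) := p :^ 4 :* con (+ 3)) refl A B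

  ψ₃-form cubic-form : Polynomial 3
  ψ₃-form = ℤP.ψ₃ (var (# 1)) (var (# 2)) (var (# 0))
  cubic-form = ℤP.cubic (var (# 1)) (var (# 2)) (var (# 0))

  tripling-form : Polynomial 4
  tripling-form = ℤP.tripling (var (# 2)) (var (# 3)) (var (# 0)) (var (# 1))

  tripling-diagonal : ∀ A B t c → ℤF.ψ₃ A B t ≡ + 0 → c * c ≡ ℤF.cubic A B t →
    ℤF.tripling A B t t ≡ (+ 2 * c) ^ 6
  tripling-diagonal A B t c ψ₃≡0 c²≡cubic = begin
    ℤF.tripling A B t t
      ≡⟨ diagonal A B t ⟩
    + 64 * (C * C * C) - + 8 * C * (+ 3 * t * t + A) * ℤF.ψ₃ A B t
      ≡⟨ cong₂ (λ C Ψ → + 64 * (C * C * C) - + 8 * C * (+ 3 * t * t + A) * Ψ) (sym c²≡cubic) ψ₃≡0 ⟩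
    + 64 * (c * c * (c * c) * (c * c)) - + 8 * (c * c) * (+ 3 * t * t + A) * + 0
      ≡⟨ solve 2 (λ c F → con (+ 64) :* (c :* c :* (c :* c) :* (c :* c)) :- con (+ 8) :* (c :* c) :* F :* con (+ 0)
           := (con (+ 2) :* c) :^ 6) refl c (+ 3 * t * t + A) ⟩
    (+ 2 * c) ^ 6
      ∎
    where
    C = ℤF.cubic A B t
    diagonal : ∀ A B t → ℤF.tripling A B t t
      ≡ + 64 * (ℤF.cubic A B t * ℤF.cubic A B t * ℤF.cubic A B t)
        - + 8 * ℤF.cubic A B t * (+ 3 * t * t + A) * ℤF.ψ₃ A B t
    diagonal = solve 3 (λ A B t → ℤP.tripling A B t t
      := con (+ 64) :* (ℤP.cubic A B t :* ℤP.cubic A B t :* ℤP.cubic A B t)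
         :- con (+ 8) :* ℤP.cubic A B t :* (con (+ 3) :* t :* t :+ A) :* ℤP.ψ₃ A B t) refl

  a-b∣[2c]⁶ : ∀ A B a b c → ℤF.ψ₃ A B b ≡ + 0 → c * c ≡ ℤF.cubic A B b → ℤF.tripling A B a b ≡ + 0 →
    (a - b) ∣ (+ 2 * c) ^ 6
  a-b∣[2c]⁶ A B a b c ψ₃≡0 c²≡cubic tripling≡0 =
    subst ((a - b) ∣_) difference (∣m⇒∣-m (a-b∣p[a]-p[b] tripling-form a b (b ∷ A ∷ B ∷ [])))
    where
    difference : - (ℤF.tripling A B a b - ℤF.tripling A B b b) ≡ (+ 2 * c) ^ 6
    difference = begin
      - (ℤF.tripling A B a b - ℤF.tripling A B b b) ≡⟨ cong₂ (λ u v → - (u - v)) tripling≡0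
                                                        (tripling-diagonal A B b c ψ₃≡0 c²≡cubic) ⟩
      - (+ 0 - (+ 2 * c) ^ 6)                       ≡⟨ cong -_ (+-identityˡ (- (+ 2 * c) ^ 6)) ⟩
      - - (+ 2 * c) ^ 6                             ≡⟨ neg-involutive ((+ 2 * c) ^ 6) ⟩
      (+ 2 * c) ^ 6                                 ∎

  integral-coordinates : ∀ A B {x x′ y′} → TriplingRelations A B x x′ y′ →
    Σ ℤ λ a → Σ ℤ λ b → Σ ℤ λ c → (x ≡ ι a) × (x′ ≡ ι b) × (y′ ≡ ι c) × ((a - b) ∣ᵤ ((+ 2) * c) ^ 6)
  integral-coordinates A B {x} {x′} {y′} relations =
    a , b , c , x≡a , x′≡b , y′≡c , ∣⇒∣ᵤ (a-b∣[2c]⁶ A B a b c ψ₃[b]≡0 c²≡cubic[b] tripling[a,b]≡0)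
    where
    open TriplingRelations relations
    a = ↥ x
    b = ↥ x′
    c = ↥ y′
    x′≡b : x′ ≡ ι b
    x′≡b = ψ₃-root-integral A B x′ ψ₃-root
    y′²≡cubic[b] : y′ ℚ.* y′ ≡ ι (ℤF.cubic A B b)
    y′²≡cubic[b] = trans on-curve
      (trans (cong (ℚF.cubic (ι A) (ι B)) x′≡b) (sym (ι-⟦⟧ cubic-form (b ∷ A ∷ B ∷ []))))
    y′≡c : y′ ≡ ι c
    y′≡c = square-integral (ℤF.cubic A B b) y′ y′²≡cubic[b]
    x≡a : x ≡ ι a
    x≡a = tripling-root-integral A B b x (subst (λ t → ℚF.tripling (ι A) (ι B) x t ≡ 0ℚ) x′≡b tripling-root)
    ψ₃[b]≡0 : ℤF.ψ₃ A B b ≡ + 0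
    ψ₃[b]≡0 = ι-⟦⟧-injective ψ₃-form (b ∷ A ∷ B ∷ [])
      (trans (cong (ℚF.ψ₃ (ι A) (ι B)) (sym x′≡b)) ψ₃-root)
    c²≡cubic[b] : c * c ≡ ℤF.cubic A B b
    c²≡cubic[b] = ι-injective
      (trans (ι-* c c) (trans (cong₂ ℚ._*_ (sym y′≡c) (sym y′≡c)) y′²≡cubic[b]))
    tripling[a,b]≡0 : ℤF.tripling A B a b ≡ + 0
    tripling[a,b]≡0 = ι-⟦⟧-injective tripling-form (a ∷ b ∷ A ∷ B ∷ [])
      (trans (cong₂ (ℚF.tripling (ι A) (ι B)) (sym x≡a) (sym x′≡b)) tripling-root)

open import Data.Integer.Base using (_+_; _*_; _-_; _^_)
open import Data.Integer.Divisibility using (_∣_)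
open import Data.Product.Base using (Σ; _×_)
open TriplingOfOrderNine using (order-9⇒tripling-relations)
open IntegralCoordinates using (integral-coordinates)

mainTheorem2 : (A B : ℤ) → (+ 4) * A ^ 3 + (+ 27) * B ^ 2 ≢ + 0 →
    (x y x′ y′ : ℚ) → onCurve A B x y → HasOrder A B (aff x y) 9 →
    mul A B 3 (aff x y) ≡ aff x′ y′ →
    Σ ℤ λ a → Σ ℤ λ b → Σ ℤ λ c →
      (x ≡ ι a) × (x′ ≡ ι b) × (y′ ≡ ι c) × ((a - b) ∣ ((+ 2) * c) ^ 6)
mainTheorem2 A B _ x y x′ y′ on-curve order [3]P≡ =
  integral-coordinates A B (order-9⇒tripling-relations A B {x} {y} {x′} {y′} on-curve order [3]P≡)
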